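{- Let $\mathcal{O}$ be an order of an algebraic number field and let $n\ge 2$ be an integer. Then every matrix in $M_n(\mathcal{O})$ is a sum of eighth powers of matrices in $M_n(\mathcal{O})$ if and only if $\gcd(2,\operatorname{disc}\mathcal{O})=1$.
   Context: An order of an algebraic number field $K$ of degree $m$ is a subring of $K$ containing $1$ which is a free $\mathbb{Z}$-module of rank $m$. $\operatorname{disc}\mathcal{O}$ is the discriminant of $\mathcal{O}$. A matrix $M$ is a sum of eighth powers in $M_n(\mathcal{O})$ if $M=\sum_{i=1}^r M_i^8$ for some $r\ge1$ and $M_i\in M_n(\mathcal{O})$. -}

module Defs where

open import Data.Nat using (ℕ; zero; suc)
open import Data.Fin using (Fin; zero; suc; punchIn; _≟_)
open import Data.Integer using (ℤ; +_; _+_; _*_; -_; 0ℤ; 1ℤ)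
open import Data.Product using (Σ; ∃; _×_; _,_)
open import Data.Sum using (_⊎_)
open import Relation.Binary.PropositionalEquality using (_≡_)
open import Relation.Nullary using (yes; no)

Σℤ : (k : ℕ) → (Fin k → ℤ) → ℤ
Σℤ zero    f = 0ℤ
Σℤ (suc k) f = f zero + Σℤ k (λ i → f (suc i))

det : (k : ℕ) → (Fin k → Fin k → ℤ) → ℤ
det zero    a = 1ℤ
det (suc k) a = alt (suc k) (λ j → a zero j * det k (λ r c → a (suc r) (punchIn j c)))
  where
  alt : (l : ℕ) → (Fin l → ℤ) → ℤ
  alt zero    f = 0ℤ
  alt (suc l) f = f zero + - alt l (λ i → f (suc i))

-- Elements of a free ℤ-module of rank m, written in coordinates
-- with respect to a fixed ℤ-basis e_0, …, e_{m-1}.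
El : ℕ → Set
El m = Fin m → ℤ

_≈_ : ∀ {m} → El m → El m → Set
x ≈ y = ∀ k → x k ≡ y k

zeroE : ∀ {m} → El m
zeroE k = 0ℤ

addE : ∀ {m} → El m → El m → El m
addE x y k = x k + y k

basis : ∀ {m} → Fin m → El m
basis i k with i ≟ k
... | yes _ = 1ℤ
... | no  _ = 0ℤ

-- Bilinear multiplication determined by structure constants
-- e_i e_j = Σ_k c i j k e_k.
mulWith : ∀ {m} → (Fin m → Fin m → Fin m → ℤ) → El m → El m → El m
mulWith {m} c x y k = Σℤ m (λ i → Σℤ m (λ j → x i * y j * c i j k))

-- An order of an algebraic number field of degree m, given concretely:
-- a ring structure on ℤ^m (free ℤ-module of rank m) that is commutative,
-- associative, unital, and an integral domain.  Such a ring is exactly an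
-- order of the number field K = O ⊗ ℚ (a finite-dimensional ℚ-domain, hence
-- a field of degree m), and every order arises this way.
record Order (m : ℕ) : Set where
  field
    str   : Fin m → Fin m → Fin m → ℤ
    one   : El m
    mul-comm  : ∀ x y → mulWith str x y ≈ mulWith str y x
    mul-assoc : ∀ x y z →
      mulWith str (mulWith str x y) z ≈ mulWith str x (mulWith str y z)
    mul-one   : ∀ x → mulWith str one x ≈ x
    domain    : ∀ x y → mulWith str x y ≈ zeroE → (x ≈ zeroE) ⊎ (y ≈ zeroE)

module _ {m : ℕ} (O : Order m) where
  open Order O

  mulO : El m → El m → El m
  mulO = mulWith str

  trace : El m → ℤ
  trace x = Σℤ m (λ i → mulO x (basis i) i)

  disc : ℤ
  disc = det m (λ i j → trace (mulO (basis i) (basis j)))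

  Mat : ℕ → Set
  Mat n = Fin n → Fin n → El m

  _≈M_ : ∀ {n} → Mat n → Mat n → Set
  A ≈M B = ∀ i j → A i j ≈ B i j

  zeroM : ∀ {n} → Mat n
  zeroM i j = zeroE

  addM : ∀ {n} → Mat n → Mat n → Mat n
  addM A B i j = addE (A i j) (B i j)

  mulM : ∀ {n} → Mat n → Mat n → Mat n
  mulM {n} A B i j k = Σℤ n (λ l → mulO (A i l) (B l j) k)

  pow8 : ∀ {n} → Mat n → Mat n
  pow8 A = let A2 = mulM A A ; A4 = mulM A2 A2 in mulM A4 A4

  sumM : ∀ {n} (r : ℕ) → (Fin r → Mat n) → Mat n
  sumM zero    Ms = zeroM
  sumM (suc r) Ms = addM (Ms zero) (sumM r (λ i → Ms (suc i)))

  SumOfEighthPowers : ∀ {n} → Mat n → Set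
  SumOfEighthPowers {n} M =
    Σ ℕ λ r → Σ (Fin (suc r) → Mat n) λ Ms → sumM (suc r) (λ i → pow8 (Ms i)) ≈M M

{-# OPTIONS --safe #-}
module Submission where

-- Both sides are equivalent to: every element of B = O / 2 O is a square.
--
-- Modulo 2 the discriminant is det of the Gram matrix of the trace form of B. If it is odd, the trace form is
-- nondegenerate, and x² = 0 gives tr (x y) = tr ((x y)²) = 0 for all y, so that squaring is injective on the finite
-- ring B, hence bijective. Conversely, if squaring is bijective then every b satisfies b ^ (2 ^ N) = b, so the operator
-- ad b = [b , -] on End B has (ad b) ^ (2 ^ N) = ad b, and the product of the projections 1 - (ad b) ^ (2 ^ N - 1) maps
-- every linear φ to a multiplication by some c without changing tr (x φ). For φ z = z_i · 1 this says
-- x_i = tr (x c), so the trace form is nondegenerate.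
--
-- If all matrices are sums of eighth powers, then comparing traces modulo 2, where tr (A²) = (tr A)², shows that every
-- element of B is a square. Conversely, it is enough to treat 2 × 2 matrices. Idempotents are eighth powers and - 1 is
-- a sum of two, so all off-diagonal and all traceless diagonal matrices are sums of eighth powers, and what remains are
-- the multiples x E₁₁. The x that occur form an additive group containing all y⁸ and all traces of C⁸, hence
-- 8 O and all 4 y², 2 y⁴; with x = y² + 2 z these give 4 O, then 2 O, then O.

open import Algebra.Bundles using (CommutativeRing)

-- Determinants over the field with two elements, by counting solutions of linear systems.

module BooleanDeterminant where

  open import Data.Bool using (Bool; true; false; _∧_; _xor_)
  open import Data.Bool.Properties
  open import Data.Fin using (Fin; zero; suc; punchIn; toℕ; funToFin; finToFun)
  open import Data.Fin.Properties using (pigeonhole; finToFun-funToFin)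
  open import Data.Nat using (ℕ; zero; suc; _<_; s≤s; _+_; _^_)
  import Data.Nat.Properties as ℕ
  open import Data.Product using (∃; _,_)
  open import Data.Vec using (Vec; []; _∷_; lookup; insertAt; replicate; tabulate; zipWith)
  open import Data.Vec.Properties
    using (insertAt-lookup; insertAt-punchIn; lookup-zipWith; lookup-replicate; lookup∘tabulate; ∷-injectiveˡ; ∷-injectiveʳ)
  open import Relation.Binary.PropositionalEquality
  open import Relation.Nullary using (contradiction)

  open import Algebra.Properties.Semiring.Sum (CommutativeRing.semiring xor-∧-commutativeRing) public
    using (sum; sum-cong-≗; sum-remove; ∑-distrib-+; ∑-comm; *-distribʳ-sum; sum-replicate-zero)

  open ≡-Reasoning

  -- Signs disappear modulo 2, so this first-row expansion is the determinant and the permanent at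
  -- once.
  det₂ : ∀ n → (Fin n → Fin n → Bool) → Bool
  det₂ zero    a = true
  det₂ (suc n) a = sum (λ j → a zero j ∧ det₂ n (λ r c → a (suc r) (punchIn j c)))

  -- For an indicator function `F` this is the parity of the number of vectors at which `F` holds.
  sumV : ∀ n → (Vec Bool n → Bool) → Bool
  sumV zero    F = F []
  sumV (suc n) F = sumV n (λ x → F (false ∷ x)) xor sumV n (λ x → F (true ∷ x))

  sumV-cong : ∀ n {F G : Vec Bool n → Bool} → (∀ x → F x ≡ G x) → sumV n F ≡ sumV n G
  sumV-cong zero    e = e []
  sumV-cong (suc n) e = cong₂ _xor_ (sumV-cong n (λ x → e (false ∷ x))) (sumV-cong n (λ x → e (true ∷ x)))

  xor-interchange : ∀ a b c d → (a xor b) xor (c xor d) ≡ (a xor c) xor (b xor d)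
  xor-interchange a b c d = begin
    (a xor b) xor (c xor d) ≡⟨ xor-assoc a b _ ⟩
    a xor (b xor (c xor d)) ≡⟨ cong (a xor_) (sym (xor-assoc b c d)) ⟩
    a xor ((b xor c) xor d) ≡⟨ cong (λ e → a xor (e xor d)) (xor-comm b c) ⟩
    a xor ((c xor b) xor d) ≡⟨ cong (a xor_) (xor-assoc c b d) ⟩
    a xor (c xor (b xor d)) ≡⟨ sym (xor-assoc a c _) ⟩
    (a xor c) xor (b xor d) ∎

  sumV-xor : ∀ n (F G : Vec Bool n → Bool) → sumV n (λ x → F x xor G x) ≡ sumV n F xor sumV n G
  sumV-xor zero    F G = refl
  sumV-xor (suc n) F G = trans
    (cong₂ _xor_ (sumV-xor n _ _) (sumV-xor n _ _))
    (xor-interchange (sumV n (λ x → F (false ∷ x))) _ _ _)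

  sumV-∧ : ∀ n c (F : Vec Bool n → Bool) → sumV n (λ x → c ∧ F x) ≡ c ∧ sumV n F
  sumV-∧ zero    c F = refl
  sumV-∧ (suc n) c F = trans (cong₂ _xor_ (sumV-∧ n c _) (sumV-∧ n c _)) (sym (∧-distribˡ-xor c _ _))

  sumV-false : ∀ n → sumV n (λ _ → false) ≡ false
  sumV-false n = sumV-∧ n false (λ _ → false)

  sumV-sum : ∀ n {k} (F : Fin k → Vec Bool n → Bool) →
    sumV n (λ x → sum (λ j → F j x)) ≡ sum (λ j → sumV n (F j))
  sumV-sum n {zero}  F = sumV-false n
  sumV-sum n {suc k} F = trans (sumV-xor n _ _) (cong (sumV n (F zero) xor_) (sumV-sum n (λ j → F (suc j))))

  -- The factor `lookup x j` removes the vectors that are false at position `j`; inserting true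
  -- there enumerates the others.
  sumV-coordinate : ∀ n (j : Fin (suc n)) (F : Vec Bool (suc n) → Bool) →
    sumV (suc n) (λ x → lookup x j ∧ F x) ≡ sumV n (λ y → F (insertAt y j true))
  sumV-coordinate n zero F = cong (_xor sumV n (λ x → F (true ∷ x))) (sumV-false n)
  sumV-coordinate (suc n) (suc j) F =
    cong₂ _xor_ (sumV-coordinate n j (λ x → F (false ∷ x))) (sumV-coordinate n j (λ x → F (true ∷ x)))

  infixl 6 _⊕_
  _⊕_ : ∀ {n} → Vec Bool n → Vec Bool n → Vec Bool n
  _⊕_ = zipWith _xor_

  𝟎 : ∀ {n} → Vec Bool n
  𝟎 = replicate _ false

  sumV-translate : ∀ n z (F : Vec Bool n → Bool) → sumV n (λ x → F (x ⊕ z)) ≡ sumV n F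
  sumV-translate zero    []          F = refl
  sumV-translate (suc n) (false ∷ z) F = cong₂ _xor_ (sumV-translate n z _) (sumV-translate n z _)
  sumV-translate (suc n) (true ∷ z)  F = trans
    (cong₂ _xor_ (sumV-translate n z (λ x → F (true ∷ x))) (sumV-translate n z (λ x → F (false ∷ x))))
    (xor-comm (sumV n (λ x → F (true ∷ x))) _)

  infix 8 _·_
  _·_ : ∀ {n} → (Fin n → Bool) → Vec Bool n → Bool
  a · x = sum (λ j → a j ∧ lookup x j)

  ·-insertAt : ∀ {n} (a : Fin (suc n) → Bool) (j : Fin (suc n)) v y →
    a · insertAt y j v ≡ (a j ∧ v) xor (λ c → a (punchIn j c)) · y
  ·-insertAt a j v y = trans (sum-remove {i = j} (λ l → a l ∧ lookup (insertAt y j v) l))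
    (cong₂ _xor_ (cong (a j ∧_) (insertAt-lookup y j v))
      (sum-cong-≗ (λ c → cong (a (punchIn j c) ∧_) (insertAt-punchIn y j v c))))

  ·-⊕ : ∀ {n} (a : Fin n → Bool) x y → a · (x ⊕ y) ≡ a · x xor a · y
  ·-⊕ a x y = trans
    (sum-cong-≗ (λ j → trans (cong (a j ∧_) (lookup-zipWith _xor_ j x y)) (∧-distribˡ-xor (a j) (lookup x j) (lookup y j))))
    (∑-distrib-+ (λ j → a j ∧ lookup x j) (λ j → a j ∧ lookup y j))

  product : ∀ k → (Fin k → Bool) → Bool
  product zero    f = true
  product (suc k) f = f zero ∧ product k (λ i → f (suc i))

  product-cong : ∀ k {f g : Fin k → Bool} → (∀ i → f i ≡ g i) → product k f ≡ product k g
  product-cong zero    e = refl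
  product-cong (suc k) e = cong₂ _∧_ (e zero) (product-cong k (λ i → e (suc i)))

  product-elim : ∀ k {f : Fin k → Bool} → product k f ≡ true → ∀ i → f i ≡ true
  product-elim (suc k) {f} e i with f zero in p
  product-elim (suc k) {f} e zero    | true = p
  product-elim (suc k) {f} e (suc i) | true = product-elim k e i

  product-intro : ∀ k {f : Fin k → Bool} → (∀ i → f i ≡ true) → product k f ≡ true
  product-intro zero    e = refl
  product-intro (suc k) e = cong₂ _∧_ (e zero) (product-intro k (λ i → e (suc i)))

  -- As a polynomial in `x`, a product of `k` affine forms; as an indicator function, the solution
  -- set of the system in which every form equals 1.
  affine : ∀ {k n} → (Fin k → Fin n → Bool) → (Fin k → Bool) → Vec Bool n → Bool
  affine {k} a b x = product k (λ i → a i · x xor b i)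

  minor : ∀ {k n} → (Fin (suc k) → Fin (suc n) → Bool) → Fin (suc n) → Fin k → Fin n → Bool
  minor a j r c = a (suc r) (punchIn j c)

  -- The constant terms of the rows after the first, once the j-th unknown is set to true.
  shifted : ∀ {k n} → (Fin (suc k) → Fin (suc n) → Bool) → (Fin (suc k) → Bool) → Fin (suc n) → Fin k → Bool
  shifted a b j r = (a (suc r) j ∧ true) xor b (suc r)

  -- Only the first form is multiplied out. Its term in the `j`-th unknown forces that unknown to be
  -- true and leaves `n` unknowns; its constant term drops a row and keeps all unknowns.
  sumV-affine : ∀ {k n} (a : Fin (suc k) → Fin (suc n) → Bool) b →
    sumV (suc n) (affine a b) ≡
      sum (λ j → a zero j ∧ sumV n (affine (minor a j) (shifted a b j)))
      xor (b zero ∧ sumV (suc n) (affine (λ r → a (suc r)) (λ r → b (suc r))))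
  sumV-affine {k} {n} a b = begin
    sumV (suc n) (λ x → (a zero · x xor b zero) ∧ R x)
      ≡⟨ sumV-cong (suc n) {λ x → (a zero · x xor b zero) ∧ R x} {λ x → sum (λ j → T j x) xor (b zero ∧ R x)} expand ⟩
    sumV (suc n) (λ x → sum (λ j → T j x) xor (b zero ∧ R x))
      ≡⟨ sumV-xor (suc n) (λ x → sum (λ j → T j x)) (λ x → b zero ∧ R x) ⟩
    sumV (suc n) (λ x → sum (λ j → T j x)) xor sumV (suc n) (λ x → b zero ∧ R x)
      ≡⟨ cong₂ _xor_ (sumV-sum (suc n) T) (sumV-∧ (suc n) (b zero) R) ⟩
    sum (λ j → sumV (suc n) (T j)) xor (b zero ∧ sumV (suc n) R)
      ≡⟨ cong (_xor (b zero ∧ sumV (suc n) R)) (sum-cong-≗ (λ j →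
           trans (sumV-∧ (suc n) (a zero j) (λ x → lookup x j ∧ R x)) (cong (a zero j ∧_)
             (trans (sumV-coordinate n j R) (sumV-cong n (restrict j)))))) ⟩
    sum (λ j → a zero j ∧ sumV n (affine (minor a j) (shifted a b j))) xor (b zero ∧ sumV (suc n) R) ∎
    where
    R : Vec Bool (suc n) → Bool
    R = affine (λ r → a (suc r)) (λ r → b (suc r))
    T : Fin (suc n) → Vec Bool (suc n) → Bool
    T j x = a zero j ∧ (lookup x j ∧ R x)
    expand : ∀ x → (a zero · x xor b zero) ∧ R x ≡ sum (λ j → T j x) xor (b zero ∧ R x)
    expand x = trans (∧-distribʳ-xor (R x) (a zero · x) (b zero))
      (cong (_xor (b zero ∧ R x)) (trans (*-distribʳ-sum (R x) (λ j → a zero j ∧ lookup x j))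
        (sum-cong-≗ (λ j → ∧-assoc (a zero j) (lookup x j) (R x)))))
    restrict : ∀ j y → R (insertAt y j true) ≡ affine (minor a j) (shifted a b j) y
    restrict j y = product-cong k (λ r → trans
      (cong (_xor b (suc r)) (trans (·-insertAt (a (suc r)) j true y)
        (xor-comm (a (suc r) j ∧ true) (minor a j r · y))))
      (xor-assoc (minor a j r · y) (a (suc r) j ∧ true) (b (suc r))))

  -- The polynomial has degree at most `k`, and a polynomial of degree below `n` sums to zero over
  -- the whole space, as in the Chevalley-Warning theorem.
  sumV-affine-underdetermined : ∀ {k n} → k < n → (a : Fin k → Fin n → Bool) (b : Fin k → Bool) →
    sumV n (affine a b) ≡ false
  sumV-affine-underdetermined {zero}  {suc n} _ a b = xor-same (sumV n (λ _ → true))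
  sumV-affine-underdetermined {suc k} {suc n} (s≤s k<n) a b = trans (sumV-affine a b) (cong₂ _xor_
    (trans (sum-cong-≗ (λ j → trans
        (cong (a zero j ∧_) (sumV-affine-underdetermined k<n (minor a j) (shifted a b j)))
        (∧-zeroʳ (a zero j))))
      (sum-replicate-zero (suc n)))
    (trans (cong (b zero ∧_)
        (sumV-affine-underdetermined (ℕ.m<n⇒m<1+n k<n) (λ r → a (suc r)) (λ r → b (suc r))))
      (∧-zeroʳ (b zero))))

  -- Ryser's formula for the permanent, which modulo 2 is the determinant.
  sumV-affine-square : ∀ n (a : Fin n → Fin n → Bool) (b : Fin n → Bool) → sumV n (affine a b) ≡ det₂ n a
  sumV-affine-square zero    a b = refl
  sumV-affine-square (suc n) a b = trans (sumV-affine a b) (trans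
    (cong₂ _xor_
      (sum-cong-≗ (λ j → cong (a zero j ∧_) (sumV-affine-square n (minor a j) (shifted a b j))))
      (trans (cong (b zero ∧_)
          (sumV-affine-underdetermined (ℕ.n<1+n n) (λ r → a (suc r)) (λ r → b (suc r))))
        (∧-zeroʳ (b zero))))
    (xor-identityʳ (det₂ (suc n) a)))

  -- Adding the kernel vector z swaps the solutions of a x = 1 with x_j = 0 and those with x_j = 1.
  det₂-kernel : ∀ n (a : Fin n → Fin n → Bool) → det₂ n a ≡ true →
    ∀ z → (∀ i → a i · z ≡ false) → ∀ j → lookup z j ≡ false
  det₂-kernel n a d z az j with lookup z j in zj
  ... | false = refl
  ... | true  = trans (sym d) (trans (sym (sumV-affine-square n a (λ _ → false))) (begin
    sumV n F
      ≡⟨ sumV-cong n (λ x → split (lookup x j) (F x)) ⟩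
    sumV n (λ x → (lookup x j ∧ F x) xor ((lookup x j xor true) ∧ F x))
      ≡⟨ sumV-xor n (λ x → lookup x j ∧ F x) G ⟩
    sumV n (λ x → lookup x j ∧ F x) xor sumV n G
      ≡⟨ cong (_xor sumV n G) (sym (sumV-translate n z (λ x → lookup x j ∧ F x))) ⟩
    sumV n (λ x → lookup (x ⊕ z) j ∧ F (x ⊕ z)) xor sumV n G
      ≡⟨ cong (_xor sumV n G) (sumV-cong n (λ x → cong₂ _∧_
           (trans (lookup-zipWith _xor_ j x z) (cong (lookup x j xor_) zj)) (invariant x))) ⟩
    sumV n G xor sumV n G
      ≡⟨ xor-same (sumV n G) ⟩
    false ∎))
    where
    F G : Vec Bool n → Bool
    F = affine a (λ _ → false)
    G x = (lookup x j xor true) ∧ F x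
    split : ∀ u v → v ≡ (u ∧ v) xor ((u xor true) ∧ v)
    split false v = refl
    split true  v = sym (xor-identityʳ v)
    invariant : ∀ x → F (x ⊕ z) ≡ F x
    invariant x = product-cong n (λ i → cong (_xor false) (trans (·-⊕ (a i) x z)
      (trans (cong (a i · x xor_) (az i)) (xor-identityʳ (a i · x)))))

  vec-ext : ∀ {A : Set} {n} {x y : Vec A n} → (∀ i → lookup x i ≡ lookup y i) → x ≡ y
  vec-ext {x = []}    {[]}    e = refl
  vec-ext {x = a ∷ x} {b ∷ y} e = cong₂ _∷_ (e zero) (vec-ext (λ i → e (suc i)))

  ⊕-zero⇒≡ : ∀ {n} (x y : Vec Bool n) → x ⊕ y ≡ 𝟎 → x ≡ y
  ⊕-zero⇒≡ [] [] e = refl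
  ⊕-zero⇒≡ (false ∷ x) (false ∷ y) e = cong (false ∷_) (⊕-zero⇒≡ x y (∷-injectiveʳ e))
  ⊕-zero⇒≡ (true ∷ x)  (true ∷ y)  e = cong (true ∷_) (⊕-zero⇒≡ x y (∷-injectiveʳ e))

  bit : Bool → Fin 2
  bit false = zero
  bit true  = suc zero

  bit-injective : ∀ a b → bit a ≡ bit b → a ≡ b
  bit-injective false false _ = refl
  bit-injective true  true  _ = refl

  code : ∀ {m} → Vec Bool m → Fin (2 ^ m)
  code v = funToFin (λ i → bit (lookup v i))

  code-injective : ∀ {m} (v w : Vec Bool m) → code v ≡ code w → v ≡ w
  code-injective v w e = vec-ext (λ i → bit-injective (lookup v i) (lookup w i)
    (trans (sym (finToFun-funToFin (λ i → bit (lookup v i)) i))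
      (trans (cong (λ c → finToFun c i) e) (finToFun-funToFin (λ i → bit (lookup w i)) i))))

  iter : ∀ {A : Set} → (A → A) → ℕ → A → A
  iter f zero    z = z
  iter f (suc k) z = f (iter f k z)

  iter-cancel : ∀ {A : Set} (f : A → A) → (∀ x y → f x ≡ f y → x ≡ y) →
    ∀ i {d z} → iter f i z ≡ iter f (i + d) z → z ≡ iter f d z
  iter-cancel f inj zero    e = e
  iter-cancel f inj (suc i) e = iter-cancel f inj i (inj _ _ e)

  -- Two of the first `2 ^ m + 1` iterates coincide, and injectivity cancels the applications of `f`
  -- that they share. The period has the form `suc p`, so the `p`-th iterate is a preimage of `z`.
  injective⇒periodic : ∀ {m} (f : Vec Bool m → Vec Bool m) → (∀ x y → f x ≡ f y → x ≡ y) →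
    ∀ z → ∃ λ p → iter f (suc p) z ≡ z
  injective⇒periodic {m} f inj z with pigeonhole (ℕ.n<1+n (2 ^ m)) (λ i → code (iter f (toℕ i) z))
  ... | i , j , i<j , e with ℕ.m≤n⇒∃[o]m+o≡n i<j
  ... | p , q = p , sym (iter-cancel f inj (toℕ i) (trans (code-injective _ _ e)
    (cong (λ k → iter f k z) (trans (sym q) (sym (ℕ.+-suc (toℕ i) p))))))

  sumV-point : ∀ n (F : Vec Bool n → Bool) x₀ → F x₀ ≡ true → (∀ x → F x ≡ true → x ≡ x₀) → sumV n F ≡ true
  sumV-none : ∀ n (F : Vec Bool n → Bool) → (∀ x → F x ≢ true) → sumV n F ≡ false
  sumV-none n F none = trans (sumV-cong n (λ x → ¬-not (none x))) (sumV-false n)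
  sumV-point zero    F []           e u = e
  sumV-point (suc n) F (false ∷ x₀) e u = cong₂ _xor_
    (sumV-point n (λ x → F (false ∷ x)) x₀ e (λ x f → ∷-injectiveʳ (u (false ∷ x) f)))
    (sumV-none n (λ x → F (true ∷ x)) (λ x f → contradiction (∷-injectiveˡ (u (true ∷ x) f)) λ ()))
  sumV-point (suc n) F (true ∷ x₀)  e u = cong₂ _xor_
    (sumV-none n (λ x → F (false ∷ x)) (λ x f → contradiction (∷-injectiveˡ (u (false ∷ x) f)) λ ()))
    (sumV-point n (λ x → F (true ∷ x)) x₀ e (λ x f → ∷-injectiveʳ (u (true ∷ x) f)))

  -- A matrix with trivial kernel permutes the vectors, so the system with all right-hand sides 1
  -- has exactly one solution. The determinant is the parity of the number of solutions.
  det₂-injective : ∀ n (a : Fin n → Fin n → Bool) →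
    (∀ z → (∀ i → a i · z ≡ false) → z ≡ 𝟎) → det₂ n a ≡ true
  det₂-injective n a inj with injective⇒periodic f f-injective (replicate n true)
    where
    f : Vec Bool n → Vec Bool n
    f x = tabulate (λ i → a i · x)
    f-injective : ∀ x y → f x ≡ f y → x ≡ y
    f-injective x y e = ⊕-zero⇒≡ x y (inj (x ⊕ y) (λ i → begin
      a i · (x ⊕ y)           ≡⟨ ·-⊕ (a i) x y ⟩
      a i · x xor a i · y     ≡⟨ cong (_xor a i · y) (trans (sym (lookup∘tabulate (λ i → a i · x) i))
                                   (trans (cong (λ v → lookup v i) e) (lookup∘tabulate (λ i → a i · y) i))) ⟩
      a i · y xor a i · y     ≡⟨ xor-same (a i · y) ⟩
      false ∎))
  ... | p , e = trans (sym (sumV-affine-square n a (λ _ → false)))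
    (sumV-point n (affine a (λ _ → false)) x₀
      (product-intro n (λ i → trans (xor-identityʳ (a i · x₀)) (solves i)))
      (λ x s → ⊕-zero⇒≡ x x₀ (inj (x ⊕ x₀) (λ i → trans (·-⊕ (a i) x x₀)
        (cong₂ _xor_ (trans (sym (xor-identityʳ (a i · x))) (product-elim n s i)) (solves i))))))
    where
    x₀ : Vec Bool n
    -- The all-ones vector lies on a cycle of the permutation; its predecessor on that cycle is the
    -- solution.
    x₀ = iter (λ x → tabulate (λ i → a i · x)) p (replicate n true)
    solves : ∀ i → a i · x₀ ≡ true
    solves i = trans (sym (lookup∘tabulate (λ i → a i · x₀) i))
      (trans (cong (λ v → lookup v i) e) (lookup-replicate i true))

-- Symmetric sums and traces in characteristic 2.

module Characteristic2 {c ℓ} (R : CommutativeRing c ℓ)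
  (double : ∀ x → CommutativeRing._≈_ R (CommutativeRing._+_ R x x) (CommutativeRing.0# R)) where

  open import Data.Fin using (Fin; zero; suc)
  open import Data.Nat using (zero; suc)
  import Relation.Binary.Reasoning.Setoid as SetoidReasoning

  open CommutativeRing R hiding (zero)
  open import Algebra.Properties.Semiring.Sum semiring
  open SetoidReasoning setoid

  -- The terms at `(i , j)` and `(j , i)` cancel: in the induction, first row and first column both
  -- contribute `A`.
  sum-symmetric : ∀ {n} (s : Fin n → Fin n → Carrier) → (∀ i j → s i j ≈ s j i) →
    sum (λ i → sum (λ j → s i j)) ≈ sum (λ i → s i i)
  sum-symmetric {zero}  s sy = refl
  sum-symmetric {suc n} s sy = begin
    (s zero zero + A) + sum (λ i → s (suc i) zero + sum (λ j → s (suc i) (suc j)))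
      ≈⟨ +-congˡ (∑-distrib-+ (λ i → s (suc i) zero) (λ i → sum (λ j → s (suc i) (suc j)))) ⟩
    (s zero zero + A) + (sum (λ i → s (suc i) zero) + S)
      ≈⟨ +-congˡ (+-cong (sum-cong-≋ (λ i → sy (suc i) zero))
           (sum-symmetric (λ i j → s (suc i) (suc j)) (λ i j → sy (suc i) (suc j)))) ⟩
    (s zero zero + A) + (A + D)
      ≈⟨ +-assoc (s zero zero) A (A + D) ⟩
    s zero zero + (A + (A + D))
      ≈⟨ +-congˡ (trans (sym (+-assoc A A D)) (trans (+-congʳ (double A)) (+-identityˡ D))) ⟩
    s zero zero + D ∎
    where
    A = sum (λ j → s zero (suc j))
    S = sum (λ i → sum (λ j → s (suc i) (suc j)))
    D = sum (λ i → s (suc i) (suc i))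

  sum-square : ∀ {n} (f : Fin n → Carrier) → sum f * sum f ≈ sum (λ i → f i * f i)
  sum-square f = trans (*-distribʳ-sum (sum f) f)
    (trans (sum-cong-≋ (λ i → *-distribˡ-sum (f i) f))
      (sum-symmetric (λ i j → f i * f j) (λ i j → *-comm (f i) (f j))))

  -- The products `A i l * A l i` are symmetric in `i` and `l`, so only the squares of the diagonal
  -- entries remain. The identity serves twice: for traces of operators, and for traces of matrices
  -- over the order modulo 2.
  trace-square : ∀ {n} (A : Fin n → Fin n → Carrier) →
    sum (λ i → sum (λ l → A i l * A l i)) ≈ sum (λ i → A i i) * sum (λ i → A i i)
  trace-square A = trans (sum-symmetric (λ i l → A i l * A l i) (λ i l → *-comm (A i l) (A l i)))
    (sym (sum-square (λ i → A i i)))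

-- Finite commutative algebras over the field with two elements and their trace forms.

module BooleanAlgebras where

  open BooleanDeterminant
  open import Data.Bool using (Bool; true; false; _∧_; _xor_)
  open import Data.Bool.Properties
  open import Data.Fin using (Fin; zero; suc)
  open import Data.Nat using (ℕ; zero; suc)
  open import Data.Product using (∃; _,_)
  open import Data.Vec using (Vec; []; _∷_; lookup)
  open import Data.Vec.Properties using (lookup-zipWith; lookup-replicate; zipWith-identityˡ; zipWith-comm; zipWith-assoc)
  open import Function using (_∘_)
  open import Level using (0ℓ)
  open import Relation.Binary.PropositionalEquality

  ⊕-same : ∀ {n} (x : Vec Bool n) → x ⊕ x ≡ 𝟎
  ⊕-same []      = refl
  ⊕-same (b ∷ x) = cong₂ _∷_ (xor-same b) (⊕-same x)

  ⊕-identityˡ : ∀ {n} (x : Vec Bool n) → 𝟎 ⊕ x ≡ x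
  ⊕-identityˡ = zipWith-identityˡ xor-identityˡ

  ⊕-comm : ∀ {n} (x y : Vec Bool n) → x ⊕ y ≡ y ⊕ x
  ⊕-comm = zipWith-comm xor-comm

  ⊕-assoc : ∀ {n} (x y z : Vec Bool n) → (x ⊕ y) ⊕ z ≡ x ⊕ (y ⊕ z)
  ⊕-assoc = zipWith-assoc xor-assoc

  ⊕-identityʳ : ∀ {n} (x : Vec Bool n) → x ⊕ 𝟎 ≡ x
  ⊕-identityʳ x = trans (⊕-comm x 𝟎) (⊕-identityˡ x)

  -- The only scalars are 0 and 1, so the additive maps are exactly the linear ones.
  Additive : ∀ {n} → (Vec Bool n → Vec Bool n) → Set
  Additive φ = ∀ x y → φ (x ⊕ y) ≡ φ x ⊕ φ y

  additive-𝟎 : ∀ {n} {φ : Vec Bool n → Vec Bool n} → Additive φ → φ 𝟎 ≡ 𝟎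
  additive-𝟎 {φ = φ} add = trans (cong φ (sym (⊕-same 𝟎))) (trans (add 𝟎 𝟎) (⊕-same (φ 𝟎)))

  unit : ∀ {n} → Fin n → Vec Bool n
  unit zero    = true ∷ 𝟎
  unit (suc i) = false ∷ unit i

  functional-expand : ∀ {n} (ℓ : Vec Bool n → Bool) → (∀ x y → ℓ (x ⊕ y) ≡ ℓ x xor ℓ y) →
    ∀ x → ℓ x ≡ sum (λ j → lookup x j ∧ ℓ (unit j))
  functional-expand ℓ add []      = trans (cong ℓ (sym (⊕-same []))) (trans (add [] []) (xor-same (ℓ [])))
  functional-expand ℓ add (b ∷ x) = trans (cong ℓ (cong₂ _∷_ (sym (xor-identityʳ b)) (sym (⊕-identityˡ x))))
    (trans (add (b ∷ 𝟎) (false ∷ x)) (cong₂ _xor_ (head b)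
      (functional-expand (λ y → ℓ (false ∷ y)) (λ y z → add (false ∷ y) (false ∷ z)) x)))
    where
    head : ∀ b → ℓ (b ∷ 𝟎) ≡ b ∧ ℓ (true ∷ 𝟎)
    head true  = refl
    head false = trans (cong ℓ (sym (⊕-same 𝟎))) (trans (add 𝟎 𝟎) (xor-same (ℓ 𝟎)))

  Tr : ∀ {n} → (Vec Bool n → Vec Bool n) → Bool
  Tr φ = sum (λ i → lookup (φ (unit i)) i)

  lookup-⊕ : ∀ {n} (x y : Vec Bool n) i → lookup (x ⊕ y) i ≡ lookup x i xor lookup y i
  lookup-⊕ x y i = lookup-zipWith _xor_ i x y

  entry-∘ : ∀ {n} {φ : Vec Bool n → Vec Bool n} → Additive φ → ∀ (ψ : Vec Bool n → Vec Bool n) i →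
    lookup (φ (ψ (unit i))) i ≡ sum (λ j → lookup (φ (unit j)) i ∧ lookup (ψ (unit i)) j)
  entry-∘ {φ = φ} add ψ i = trans
    (functional-expand (λ x → lookup (φ x) i)
      (λ x y → trans (cong (λ v → lookup v i) (add x y)) (lookup-⊕ (φ x) (φ y) i)) (ψ (unit i)))
    (sum-cong-≗ (λ j → ∧-comm (lookup (ψ (unit i)) j) (lookup (φ (unit j)) i)))

  Tr-∘-comm : ∀ {n} {φ ψ : Vec Bool n → Vec Bool n} → Additive φ → Additive ψ → Tr (φ ∘ ψ) ≡ Tr (ψ ∘ φ)
  Tr-∘-comm {φ = φ} {ψ} addφ addψ = trans
    (sum-cong-≗ (entry-∘ addφ ψ))
    (trans (∑-comm (λ i j → lookup (φ (unit j)) i ∧ lookup (ψ (unit i)) j))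
      (sum-cong-≗ (λ j → trans
        (sum-cong-≗ (λ i → ∧-comm (lookup (φ (unit j)) i) (lookup (ψ (unit i)) j)))
        (sym (entry-∘ addψ φ j)))))

  Tr-⊕ : ∀ {n} (φ ψ : Vec Bool n → Vec Bool n) → Tr (λ x → φ x ⊕ ψ x) ≡ Tr φ xor Tr ψ
  Tr-⊕ φ ψ = trans (sum-cong-≗ (λ i → lookup-⊕ (φ (unit i)) (ψ (unit i)) i))
    (∑-distrib-+ (λ i → lookup (φ (unit i)) i) (λ i → lookup (ψ (unit i)) i))

  Tr-cong : ∀ {n} {φ ψ : Vec Bool n → Vec Bool n} → (∀ x → φ x ≡ ψ x) → Tr φ ≡ Tr ψ
  Tr-cong e = sum-cong-≗ (λ i → cong (λ v → lookup v i) (e (unit i)))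

  -- The trace of the square is the square of the trace, and every element of the base field equals
  -- its own square.
  Tr-square : ∀ {n} {φ : Vec Bool n → Vec Bool n} → Additive φ → Tr (φ ∘ φ) ≡ Tr φ
  Tr-square {φ = φ} add = trans (sum-cong-≗ (entry-∘ add φ))
    (trans (trace-square (λ i j → lookup (φ (unit j)) i)) (∧-idem (Tr φ)))
    where open Characteristic2 xor-∧-commutativeRing xor-same

  ⊕-interchange : ∀ {n} (a b c d : Vec Bool n) → (a ⊕ b) ⊕ (c ⊕ d) ≡ (a ⊕ c) ⊕ (b ⊕ d)
  ⊕-interchange a b c d = vec-ext (λ i → trans (lookup-⊕ (a ⊕ b) (c ⊕ d) i)
    (trans (cong₂ _xor_ (lookup-⊕ a b i) (lookup-⊕ c d i))
      (trans (xor-interchange (lookup a i) (lookup b i) (lookup c i) (lookup d i))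
        (sym (trans (lookup-⊕ (a ⊕ c) (b ⊕ d) i) (cong₂ _xor_ (lookup-⊕ a c i) (lookup-⊕ b d i)))))))

  record F₂Algebra (m : ℕ) : Set where
    infixl 7 _*_
    field
      _*_         : Vec Bool m → Vec Bool m → Vec Bool m
      1#          : Vec Bool m
      *-comm      : ∀ x y → x * y ≡ y * x
      *-assoc     : ∀ x y z → (x * y) * z ≡ x * (y * z)
      *-identityˡ : ∀ x → 1# * x ≡ x
      distribˡ    : ∀ x y z → x * (y ⊕ z) ≡ x * y ⊕ x * z

    distribʳ : ∀ x y z → (y ⊕ z) * x ≡ y * x ⊕ z * x
    distribʳ x y z = trans (*-comm (y ⊕ z) x) (trans (distribˡ x y z) (cong₂ _⊕_ (*-comm x y) (*-comm x z)))

    square : Vec Bool m → Vec Bool m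
    square x = x * x

    square-⊕ : Additive square
    square-⊕ x y = trans (distribˡ (x ⊕ y) x y) (trans (cong₂ _⊕_ (distribʳ x x y) (distribʳ y x y))
      (trans (⊕-assoc (x * x) (y * x) (x * y ⊕ y * y))
        (cong (x * x ⊕_) (trans (sym (⊕-assoc (y * x) (x * y) (y * y)))
          (trans (cong (_⊕ y * y) (trans (cong (_⊕ x * y) (*-comm y x)) (⊕-same (x * y))))
            (⊕-identityˡ (y * y)))))))

    square-* : ∀ x y → square (x * y) ≡ square x * square y
    square-* x y = trans (*-assoc x y (x * y)) (trans (cong (x *_) (trans (sym (*-assoc y x y))
      (trans (cong (_* y) (*-comm y x)) (*-assoc x y y)))) (sym (*-assoc x x (y * y))))

    zeroʳ : ∀ x → x * 𝟎 ≡ 𝟎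
    zeroʳ x = additive-𝟎 (distribˡ x)

    zeroˡ : ∀ x → 𝟎 * x ≡ 𝟎
    zeroˡ x = trans (*-comm 𝟎 x) (zeroʳ x)

    tr : Vec Bool m → Bool
    tr x = Tr (x *_)

    tr-⊕ : ∀ x y → tr (x ⊕ y) ≡ tr x xor tr y
    tr-⊕ x y = trans (Tr-cong (λ z → distribʳ z x y)) (Tr-⊕ (x *_) (y *_))

    tr-square : ∀ x → tr (square x) ≡ tr x
    tr-square x = trans (Tr-cong (*-assoc x x)) (Tr-square (distribˡ x))

    gram : Fin m → Fin m → Bool
    gram i j = tr (unit i * unit j)

    gram-· : ∀ i x → gram i · x ≡ tr (unit i * x)
    gram-· i x = trans (sum-cong-≗ (λ j → ∧-comm (gram i j) (lookup x j)))
      (sym (functional-expand (λ y → tr (unit i * y))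
        (λ y z → trans (cong tr (distribˡ (unit i) y z)) (tr-⊕ (unit i * y) (unit i * z))) x))

    lookup-𝟎⇒≡ : ∀ {x : Vec Bool m} → (∀ i → lookup x i ≡ false) → x ≡ 𝟎
    lookup-𝟎⇒≡ e = vec-ext (λ i → trans (e i) (sym (lookup-replicate i false)))

    tr-𝟎 : tr 𝟎 ≡ false
    tr-𝟎 = trans (cong tr (sym (⊕-same 𝟎))) (trans (tr-⊕ 𝟎 𝟎) (xor-same (tr 𝟎)))

    Perfect : Set
    Perfect = ∀ x → ∃ λ y → square y ≡ x

    -- Each `unit i * x` has square zero, and the trace does not change under squaring; hence the
    -- Gram matrix kills `x`.
    square-kernel : det₂ m gram ≡ true → ∀ x → square x ≡ 𝟎 → x ≡ 𝟎
    square-kernel d x x²≡0 = lookup-𝟎⇒≡ (det₂-kernel m gram d x (λ i → begin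
      gram i · x                     ≡⟨ gram-· i x ⟩
      tr (unit i * x)                ≡⟨ sym (tr-square (unit i * x)) ⟩
      tr (square (unit i * x))       ≡⟨ cong tr (trans (square-* (unit i) x) (cong (square (unit i) *_) x²≡0)) ⟩
      tr (square (unit i) * 𝟎)       ≡⟨ trans (cong tr (zeroʳ (square (unit i)))) tr-𝟎 ⟩
      false ∎))
      where open ≡-Reasoning

    -- Squaring is additive with trivial kernel, hence injective. The orbit of `x` is then a cycle,
    -- and the element before `x` on it is a square root.
    det₂⇒perfect : det₂ m gram ≡ true → Perfect
    det₂⇒perfect d x with injective⇒periodic square square-injective x
      where
      square-injective : ∀ y z → square y ≡ square z → y ≡ z
      square-injective y z e = ⊕-zero⇒≡ y z (square-kernel d (y ⊕ z)
        (trans (square-⊕ y z) (trans (cong (_⊕ square z) e) (⊕-same (square z)))))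
    ... | p , e = iter square p x , e

  algebraRing : ∀ {m} → F₂Algebra m → CommutativeRing 0ℓ 0ℓ
  algebraRing {m} B = record
    { Carrier = Vec Bool m
    ; _≈_ = _≡_
    ; _+_ = _⊕_
    ; _*_ = _*_
    ; -_ = λ x → x
    ; 0# = 𝟎
    ; 1# = 1#
    ; isCommutativeRing = record
      { isRing = record
        { +-isAbelianGroup = record
          { isGroup = record
            { isMonoid = record
              { isSemigroup = record
                { isMagma = record { isEquivalence = isEquivalence ; ∙-cong = cong₂ _⊕_ }
                ; assoc = ⊕-assoc
                }
              ; identity = ⊕-identityˡ , ⊕-identityʳ
              }
            ; inverse = ⊕-same , ⊕-same
            ; ⁻¹-cong = λ e → e
            }
          ; comm = ⊕-comm
          }
        ; *-cong = cong₂ _*_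
        ; *-assoc = *-assoc
        ; *-identity = *-identityˡ , (λ x → trans (*-comm x 1#) (*-identityˡ x))
        ; distrib = distribˡ , distribʳ
        }
      ; *-comm = *-comm
      }
    }
    where open F₂Algebra B

open import Data.Nat using (ℕ)
open BooleanAlgebras using (F₂Algebra; module F₂Algebra)

-- Nondegeneracy of the trace form of a perfect algebra.

module Separability {m : ℕ} (B : F₂Algebra m) where

  open BooleanDeterminant
  open BooleanAlgebras
  open import Data.Bool using (Bool; true; false; _∧_; _xor_)
  open import Data.Bool.Properties
  open import Data.Fin using (Fin; zero; suc)
  open import Data.Nat using (ℕ; zero; suc)
  open import Data.Product using (∃; _×_; _,_; proj₁; proj₂)
  open import Data.Vec using (Vec; lookup; map)
  open import Data.Vec.Properties using (lookup-replicate; lookup-map)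
  open import Relation.Binary.PropositionalEquality

  open F₂Algebra B

  V : Set
  V = Vec Bool m

  *-swap : ∀ x y z → x * (y * z) ≡ y * (x * z)
  *-swap x y z = trans (sym (*-assoc x y z)) (trans (cong (_* z) (*-comm x y)) (*-assoc y x z))

  -- The commutator of `φ` with multiplication by `b`, written with a plus sign because the
  -- characteristic is 2.
  U : V → (V → V) → V → V
  U b φ x = b * φ x ⊕ φ (b * x)

  _⊞_ : (V → V) → (V → V) → V → V
  (φ ⊞ ψ) x = φ x ⊕ ψ x

  ⊞-additive : ∀ {φ ψ} → Additive φ → Additive ψ → Additive (φ ⊞ ψ)
  ⊞-additive {φ} {ψ} addφ addψ x y = trans (cong₂ _⊕_ (addφ x y) (addψ x y)) (⊕-interchange (φ x) (φ y) (ψ x) (ψ y))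

  U-additive : ∀ b {φ} → Additive φ → Additive (U b φ)
  U-additive b {φ} add = ⊞-additive {λ x → b * φ x} {λ x → φ (b * x)}
    (λ x y → trans (cong (b *_) (add x y)) (distribˡ b (φ x) (φ y)))
    (λ x y → trans (cong φ (distribˡ b x y)) (add (b * x) (b * y)))

  U-cong : ∀ b {φ ψ} → (∀ x → φ x ≡ ψ x) → ∀ x → U b φ x ≡ U b ψ x
  U-cong b e x = cong₂ _⊕_ (cong (b *_) (e x)) (e (b * x))

  U-zero : ∀ b {φ} → (∀ x → φ x ≡ 𝟎) → ∀ x → U b φ x ≡ 𝟎
  U-zero b {φ} e x = trans (cong₂ _⊕_ (trans (cong (b *_) (e x)) (zeroʳ b)) (e (b * x))) (⊕-same 𝟎)

  U-⊞ : ∀ b φ ψ x → U b (φ ⊞ ψ) x ≡ U b φ x ⊕ U b ψ x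
  U-⊞ b φ ψ x = trans (cong (_⊕ (φ (b * x) ⊕ ψ (b * x))) (distribˡ b (φ x) (ψ x)))
    (⊕-interchange (b * φ x) (b * ψ x) (φ (b * x)) (ψ (b * x)))

  -- This form separates a part that depends only on `b * c` from a mixed part symmetric in `b` and
  -- `c`; both `U-comm` and `U-square` can be read off from it.
  U-U : ∀ b c φ x →
    U b (U c φ) x ≡ (b * c * φ x ⊕ φ (b * c * x)) ⊕ (b * φ (c * x) ⊕ c * φ (b * x))
  U-U b c φ x = begin
    b * (c * φ x ⊕ φ (c * x)) ⊕ (c * φ (b * x) ⊕ φ (c * (b * x)))
      ≡⟨ cong₂ _⊕_ (distribˡ b (c * φ x) (φ (c * x))) (⊕-comm (c * φ (b * x)) (φ (c * (b * x)))) ⟩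
    (b * (c * φ x) ⊕ b * φ (c * x)) ⊕ (φ (c * (b * x)) ⊕ c * φ (b * x))
      ≡⟨ ⊕-interchange (b * (c * φ x)) (b * φ (c * x)) (φ (c * (b * x))) (c * φ (b * x)) ⟩
    (b * (c * φ x) ⊕ φ (c * (b * x))) ⊕ (b * φ (c * x) ⊕ c * φ (b * x))
      ≡⟨ cong (_⊕ (b * φ (c * x) ⊕ c * φ (b * x))) (cong₂ _⊕_ (sym (*-assoc b c (φ x)))
           (cong φ (trans (*-swap c b x) (sym (*-assoc b c x))))) ⟩
    (b * c * φ x ⊕ φ (b * c * x)) ⊕ (b * φ (c * x) ⊕ c * φ (b * x)) ∎
    where open ≡-Reasoning

  U-comm : ∀ b c φ x → U b (U c φ) x ≡ U c (U b φ) x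
  U-comm b c φ x = trans (U-U b c φ x) (trans
    (cong₂ _⊕_ (cong (λ d → d * φ x ⊕ φ (d * x)) (*-comm b c)) (⊕-comm (b * φ (c * x)) (c * φ (b * x))))
    (sym (U-U c b φ x)))

  U-square : ∀ b φ x → U b (U b φ) x ≡ U (square b) φ x
  U-square b φ x = trans (U-U b b φ x) (trans
    (cong (U (square b) φ x ⊕_) (⊕-same (b * φ (b * x)))) (⊕-identityʳ (U (square b) φ x)))

  τ : V → (V → V) → Bool
  τ x φ = Tr (λ z → x * φ z)

  τ-⊞ : ∀ x φ ψ → τ x (φ ⊞ ψ) ≡ τ x φ xor τ x ψ
  τ-⊞ x φ ψ = trans (Tr-cong (λ z → distribˡ x (φ z) (ψ z))) (Tr-⊕ (λ z → x * φ z) (λ z → x * ψ z))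

  -- Multiplications by `x` and `b` commute, so cyclicity of the trace gives both halves of the
  -- commutator the same value.
  τ-U : ∀ x b {φ} → Additive φ → τ x (U b φ) ≡ false
  τ-U x b {φ} add = trans (τ-⊞ x (λ z → b * φ z) (λ z → φ (b * z)))
    (trans (cong₂ _xor_ (Tr-cong (λ z → *-swap x b (φ z)))
      (Tr-∘-comm {φ = λ z → x * φ z} {b *_} (λ y z → trans (cong (x *_) (add y z)) (distribˡ x (φ y) (φ z))) (distribˡ b)))
      (xor-same (Tr (λ z → b * (x * φ z)))))

  W : V → ℕ → (V → V) → V → V
  W b zero    φ = φ
  W b (suc N) φ = U (iter square N b) (W b N φ)

  W-additive : ∀ b N {φ} → Additive φ → Additive (W b N φ)
  W-additive b zero    add = add
  W-additive b (suc N) add = U-additive (iter square N b) (W-additive b N add)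

  W-zero : ∀ b N {φ} → (∀ x → φ x ≡ 𝟎) → ∀ x → W b N φ x ≡ 𝟎
  W-zero b zero    e = e
  W-zero b (suc N) e = U-zero (iter square N b) (W-zero b N e)

  U-W-comm : ∀ c b N φ x → U c (W b N φ) x ≡ W b N (U c φ) x
  U-W-comm c b zero    φ x = refl
  U-W-comm c b (suc N) φ x = trans (U-comm c (iter square N b) (W b N φ) x)
    (U-cong (iter square N b) (U-W-comm c b N φ) x)

  -- `W b N` composes the commutators with the first `N` iterated squares of `b`. One more
  -- commutator with `b` starts a chain: at each stage two equal commutators merge into the
  -- commutator with the next square.
  U-W : ∀ b N φ x → U b (W b N φ) x ≡ U (iter square N b) φ x
  U-W b zero    φ x = refl
  U-W b (suc N) φ x = trans (U-comm b c (W b N φ) x)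
    (trans (U-cong c (U-W b N φ) x) (U-square c φ x))
    where c = iter square N b

  -- If b is fixed by the N-th iterate of Frobenius, then W b N is U b to the power 2 ^ N - 1, and U b to the power
  -- 2 ^ N is U b; hence 1 + W b N maps every operator to one commuting with b.
  project : ℕ → V → (V → V) → V → V
  project N b φ = φ ⊞ W b N φ

  project-kills : ∀ N b → iter square N b ≡ b → ∀ φ x → U b (project N b φ) x ≡ 𝟎
  project-kills N b e φ x = trans (U-⊞ b φ (W b N φ) x)
    (trans (cong (U b φ x ⊕_) (trans (U-W b N φ x) (cong (λ c → U c φ x) e))) (⊕-same (U b φ x)))

  -- Commutators with different elements commute, so a projection does not spoil what earlier ones
  -- have achieved.
  project-preserves : ∀ N b c φ → (∀ x → U c φ x ≡ 𝟎) → ∀ x → U c (project N b φ) x ≡ 𝟎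
  project-preserves N b c φ e x = trans (U-⊞ c φ (W b N φ) x)
    (trans (cong₂ _⊕_ (e x) (trans (U-W-comm c b N φ x) (W-zero b N e x))) (⊕-same 𝟎))

  -- The correction term is itself a commutator, because the index `suc p` is positive, and
  -- commutators pair to zero with every `x`.
  τ-project : ∀ x p b φ → Additive φ → τ x (project (suc p) b φ) ≡ τ x φ
  τ-project x p b φ add = trans (τ-⊞ x φ (W b (suc p) φ))
    (trans (cong (τ x φ xor_) (τ-U x (iter square p b) (W-additive b p add))) (xor-identityʳ (τ x φ)))

  centralise : (∀ b → ∃ λ p → iter square (suc p) b ≡ b) → ∀ {k} (f : Fin k → V) φ → Additive φ →
    ∃ λ ψ → Additive ψ × (∀ i x → U (f i) ψ x ≡ 𝟎) × (∀ x → τ x ψ ≡ τ x φ)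
  centralise periodic {zero}  f φ add = φ , add , (λ ()) , λ _ → refl
  centralise periodic {suc k} f φ add with periodic (f zero) | centralise periodic (λ i → f (suc i)) φ add
  ... | p , e | ψ , addψ , central , τψ =
    project (suc p) (f zero) ψ , ⊞-additive {ψ} addψ (W-additive (f zero) (suc p) addψ) , central′ ,
    λ x → trans (τ-project x p (f zero) ψ addψ) (τψ x)
    where
    central′ : ∀ i x → U (f i) (project (suc p) (f zero) ψ) x ≡ 𝟎
    central′ zero    = project-kills (suc p) (f zero) e ψ
    central′ (suc i) = project-preserves (suc p) (f zero) (f (suc i)) ψ (central i)

  -- A vanishing commutator with `z`, evaluated at `1#`, is the claim. The commutator is additive in
  -- its element, which extends the vanishing from the basis to every `z`.
  central⇒multiplication : ∀ {ψ} → Additive ψ → (∀ i x → U (unit i) ψ x ≡ 𝟎) → ∀ z → ψ z ≡ z * ψ 1#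
  central⇒multiplication {ψ} add central z = sym (trans
    (⊕-zero⇒≡ (z * ψ 1#) (ψ (z * 1#)) (lookup-𝟎⇒≡ vanish))
    (cong ψ (trans (*-comm z 1#) (*-identityˡ z))))
    where
    vanish : ∀ i → lookup (U z ψ 1#) i ≡ false
    vanish i = trans
      (functional-expand (λ b → lookup (U b ψ 1#) i) (λ b c → trans
        (cong (λ v → lookup v i) (trans
          (cong₂ _⊕_ (distribʳ (ψ 1#) b c) (trans (cong ψ (distribʳ 1# b c)) (add (b * 1#) (c * 1#))))
          (⊕-interchange (b * ψ 1#) (c * ψ 1#) (ψ (b * 1#)) (ψ (c * 1#)))))
        (lookup-⊕ (U b ψ 1#) (U c ψ 1#) i)) z)
      (trans (sum-cong-≗ (λ j → trans
        (cong (lookup z j ∧_) (trans (cong (λ v → lookup v i) (central j 1#)) (lookup-replicate i false)))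
        (∧-zeroʳ (lookup z j)))) (sum-replicate-zero m))

  -- Taking square roots is injective because squaring undoes it, so `b` returns to itself under
  -- iterated roots. Squaring equally often gives the same period.
  perfect⇒periodic : Perfect → ∀ b → ∃ λ p → iter square (suc p) b ≡ b
  perfect⇒periodic perfect b with injective⇒periodic root
      (λ x y e → trans (sym (proj₂ (perfect x))) (trans (cong square e) (proj₂ (perfect y)))) b
    where
    root : V → V
    root x = proj₁ (perfect x)
  ... | p , e = p , trans (cong (iter square (suc p)) (sym e)) (undo (suc p) b)
    where
    root : V → V
    root x = proj₁ (perfect x)
    iter-comm : ∀ k x → iter square k (square x) ≡ square (iter square k x)
    iter-comm zero    x = refl
    iter-comm (suc k) x = cong square (iter-comm k x)
    undo : ∀ k x → iter square k (iter root k x) ≡ x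
    undo zero    x = refl
    undo (suc k) x = trans (sym (iter-comm k (root (iter root k x))))
      (trans (cong (iter square k) (proj₂ (perfect (iter root k x)))) (undo k x))

  pick : Fin m → V → V
  pick i z = map (lookup z i ∧_) 1#

  pick-additive : ∀ i → Additive (pick i)
  pick-additive i x y = vec-ext (λ k → trans (lookup-map k (lookup (x ⊕ y) i ∧_) 1#)
    (trans (cong (_∧ lookup 1# k) (lookup-⊕ x y i))
      (trans (∧-distribʳ-xor (lookup 1# k) (lookup x i) (lookup y i))
        (sym (trans (lookup-⊕ (pick i x) (pick i y) k)
          (cong₂ _xor_ (lookup-map k (lookup x i ∧_) 1#) (lookup-map k (lookup y i ∧_) 1#)))))))

  *-scale : ∀ b x y → x * map (b ∧_) y ≡ map (b ∧_) (x * y)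
  *-scale true  x y = trans (cong (x *_) (map-true y)) (sym (map-true (x * y)))
    where
    map-true : ∀ y → map (true ∧_) y ≡ y
    map-true y = vec-ext (λ i → lookup-map i (true ∧_) y)
  *-scale false x y = trans (cong (x *_) (map-false y)) (trans (zeroʳ x) (sym (map-false (x * y))))
    where
    map-false : ∀ y → map (false ∧_) y ≡ 𝟎
    map-false y = lookup-𝟎⇒≡ (λ i → lookup-map i (false ∧_) y)

  -- Of the diagonal entries of the operator that sends `z` to `z_i x`, only the one at `i` can be
  -- nonzero.
  τ-pick : ∀ x i → τ x (pick i) ≡ lookup x i
  τ-pick x i = trans (sum-cong-≗ (λ k → trans
      (cong (λ v → lookup v k) (trans (*-scale (lookup (unit k) i) x 1#)
        (cong (map (lookup (unit k) i ∧_)) (trans (*-comm x 1#) (*-identityˡ x)))))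
      (trans (lookup-map k (lookup (unit k) i ∧_) x) (∧-comm (lookup (unit k) i) (lookup x k)))))
    (sym (functional-expand (λ y → lookup y i) (λ y z → lookup-⊕ y z i) x))

  -- If the Gram matrix kills `x`, then `x` is orthogonal to everything. Its `i`-th coordinate is
  -- the pairing with `pick i`, and centralising turns this into the trace of `x * ψ 1#`.
  perfect⇒det₂ : Perfect → det₂ m gram ≡ true
  perfect⇒det₂ perfect = det₂-injective m gram λ x gx → lookup-𝟎⇒≡ (coordinate x gx)
    where
    tr-* : ∀ x → (∀ i → gram i · x ≡ false) → ∀ y → tr (x * y) ≡ false
    tr-* x gx y = trans (cong tr (*-comm x y)) (trans
      (functional-expand (λ y → tr (y * x)) (λ y z → trans (cong tr (distribʳ x y z)) (tr-⊕ (y * x) (z * x))) y)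
      (trans (sum-cong-≗ (λ j → trans (cong (lookup y j ∧_) (trans (sym (gram-· j x)) (gx j))) (∧-zeroʳ (lookup y j))))
        (sum-replicate-zero m)))
    coordinate : ∀ x → (∀ i → gram i · x ≡ false) → ∀ i → lookup x i ≡ false
    coordinate x gx i with centralise (perfect⇒periodic perfect) unit (pick i) (pick-additive i)
    ... | ψ , add , central , τψ = trans (sym (τ-pick x i)) (trans (sym (τψ x))
      (trans (Tr-cong (λ z → trans (cong (x *_) (trans (central⇒multiplication add central z) (*-comm z (ψ 1#))))
          (sym (*-assoc x (ψ 1#) z))))
        (tr-* x gx (ψ 1#))))

-- Integer coefficients for polynomial identities in an arbitrary commutative ring.

module IntegerCoefficients {c ℓ} (R : CommutativeRing c ℓ) where

  import Algebra.Properties.Ring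
  import Algebra.Properties.AbelianGroup
  import Algebra.Properties.Semiring.Mult.TCOptimised
  import Algebra.Solver.Ring
  open import Algebra.Solver.Ring.AlmostCommutativeRing using (AlmostCommutativeRing; fromCommutativeRing; _-Raw-AlmostCommutative⟶_)
  open import Data.Integer using (ℤ; +_; -[1+_]; _⊖_)
  import Data.Integer as ℤ
  import Data.Integer.Properties as ℤ
  import Data.Maybe
  open import Data.Nat as ℕ using (ℕ; zero; suc)
  import Data.Nat.Properties as ℕ
  open import Relation.Binary.PropositionalEquality using (_≡_; cong)
  import Relation.Binary.PropositionalEquality as ≡
  import Relation.Nullary.Decidable
  import Relation.Binary.Reasoning.Setoid as SetoidReasoning

  open CommutativeRing R hiding (zero)
  open Algebra.Properties.Ring ring using (-0#≈0#; -‿distribˡ-*)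
  open Algebra.Properties.AbelianGroup +-abelianGroup using (⁻¹-∙-comm; ⁻¹-involutive)
  open Algebra.Properties.Semiring.Mult.TCOptimised semiring using (×-homo-+; ×1-homo-*; 1+×) renaming (_×_ to _·_)
  open SetoidReasoning setoid

  ι : ℤ → Carrier
  ι (+ n)    = n · 1#
  ι -[1+ n ] = - (suc n · 1#)

  ι-⊖ : ∀ m n → ι (m ⊖ n) ≈ m · 1# - n · 1#
  ι-⊖ zero    zero    = sym (-‿inverseʳ 0#)
  ι-⊖ zero    (suc n) = sym (+-identityˡ (- (suc n · 1#)))
  ι-⊖ (suc m) zero    = sym (trans (+-congˡ -0#≈0#) (+-identityʳ (suc m · 1#)))
  ι-⊖ (suc m) (suc n) = begin
    ι (suc m ⊖ suc n)                          ≡⟨ cong ι (ℤ.[1+m]⊖[1+n]≡m⊖n m n) ⟩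
    ι (m ⊖ n)                                  ≈⟨ ι-⊖ m n ⟩
    m · 1# - n · 1#                            ≈⟨ +-congʳ (sym (trans (+-congʳ (-‿inverseʳ 1#)) (+-identityˡ (m · 1#)))) ⟩
    (1# - 1#) + m · 1# - n · 1#                ≈⟨ +-congʳ (trans (+-assoc 1# (- 1#) (m · 1#))
                                                    (trans (+-congˡ (+-comm (- 1#) (m · 1#))) (sym (+-assoc 1# (m · 1#) (- 1#))))) ⟩
    (1# + m · 1# - 1#) - n · 1#                ≈⟨ +-assoc (1# + m · 1#) (- 1#) (- (n · 1#)) ⟩
    1# + m · 1# + (- 1# - n · 1#)              ≈⟨ +-cong (sym (1+× m 1#)) (⁻¹-∙-comm 1# (n · 1#)) ⟩
    suc m · 1# - (1# + n · 1#)                 ≈⟨ +-congˡ (-‿cong (sym (1+× n 1#))) ⟩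
    suc m · 1# - suc n · 1#                    ∎

  ι-+ : ∀ i j → ι (i ℤ.+ j) ≈ ι i + ι j
  ι-+ (+ m)    (+ n)    = ×-homo-+ 1# m n
  ι-+ (+ m)    -[1+ n ] = ι-⊖ m (suc n)
  ι-+ -[1+ m ] (+ n)    = trans (ι-⊖ n (suc m)) (+-comm (n · 1#) (- (suc m · 1#)))
  ι-+ -[1+ m ] -[1+ n ] = begin
    - (suc (suc (m ℕ.+ n)) · 1#)      ≡⟨ cong (λ k → - (suc k · 1#)) (≡.sym (ℕ.+-suc m n)) ⟩
    - ((suc m ℕ.+ suc n) · 1#)        ≈⟨ -‿cong (×-homo-+ 1# (suc m) (suc n)) ⟩
    - (suc m · 1# + suc n · 1#)       ≈⟨ sym (⁻¹-∙-comm (suc m · 1#) (suc n · 1#)) ⟩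
    - (suc m · 1#) - suc n · 1#       ∎

  ι-neg : ∀ i → ι (ℤ.- i) ≈ - ι i
  ι-neg (+ zero)    = sym -0#≈0#
  ι-neg (+ (suc n)) = refl
  ι-neg -[1+ n ]    = sym (⁻¹-involutive (suc n · 1#))

  ι-* : ∀ i j → ι (i ℤ.* j) ≈ ι i * ι j
  ι-*₊ : ∀ m j → ι (+ m ℤ.* j) ≈ ι (+ m) * ι j
  ι-*₊ m (+ n)    = trans (reflexive (cong ι (≡.sym (ℤ.pos-* m n)))) (×1-homo-* m n)
  ι-*₊ m -[1+ n ] = begin
    ι (+ m ℤ.* -[1+ n ])        ≡⟨ cong ι (≡.sym (ℤ.neg-distribʳ-* (+ m) (+ suc n))) ⟩
    ι (ℤ.- (+ m ℤ.* + suc n))   ≈⟨ ι-neg (+ m ℤ.* + suc n) ⟩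
    - ι (+ m ℤ.* + suc n)       ≈⟨ -‿cong (ι-*₊ m (+ suc n)) ⟩
    - (m · 1# * (suc n · 1#))   ≈⟨ trans (-‿cong (*-comm (m · 1#) (suc n · 1#)))
                                     (trans (-‿distribˡ-* (suc n · 1#) (m · 1#)) (*-comm (- (suc n · 1#)) (m · 1#))) ⟩
    m · 1# * - (suc n · 1#)     ∎
  ι-* (+ m)    j = ι-*₊ m j
  ι-* -[1+ m ] j = begin
    ι (-[1+ m ] ℤ.* j)          ≡⟨ cong ι (≡.sym (ℤ.neg-distribˡ-* (+ suc m) j)) ⟩
    ι (ℤ.- (+ suc m ℤ.* j))     ≈⟨ ι-neg (+ suc m ℤ.* j) ⟩
    - ι (+ suc m ℤ.* j)         ≈⟨ -‿cong (ι-*₊ (suc m) j) ⟩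
    - (suc m · 1# * ι j)        ≈⟨ -‿distribˡ-* (suc m · 1#) (ι j) ⟩
    - (suc m · 1#) * ι j        ∎

  almost : AlmostCommutativeRing c ℓ
  almost = fromCommutativeRing R

  morphism : ℤ.+-*-rawRing -Raw-AlmostCommutative⟶ almost
  morphism = record
    { ⟦_⟧ = ι ; +-homo = ι-+ ; *-homo = ι-* ; -‿homo = ι-neg ; 0-homo = refl ; 1-homo = refl }

  ι-≟ : ∀ i j → Data.Maybe.Maybe (ι i ≈ ι j)
  ι-≟ i j = Data.Maybe.map (λ e → reflexive (cong ι e)) (Relation.Nullary.Decidable.dec⇒maybe (i ℤ.≟ j))

  module Solver = Algebra.Solver.Ring ℤ.+-*-rawRing almost morphism
    ι-≟

-- The additive group of corner entries that eighth powers produce.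

module EighthPowerTargets {c ℓ} (R : CommutativeRing c ℓ) where

  open import Data.Integer using (+_)
  open import Data.Nat using (zero; suc)
  open import Data.Product using (∃₂; _,_; _×_; proj₁)
  import Algebra.Properties.AbelianGroup
  import Algebra.Properties.Semiring.Mult.TCOptimised

  open CommutativeRing R hiding (zero)
  open IntegerCoefficients R
  open Solver
  open Algebra.Properties.AbelianGroup +-abelianGroup using (⁻¹-involutive)
  open Algebra.Properties.Semiring.Mult.TCOptimised semiring using (1+×) renaming (_×_ to _·_)

  infixl 9 _² _⁴ _⁸
  _² _⁴ _⁸ : Carrier → Carrier
  x ² = x * x
  x ⁴ = x ² ²
  x ⁸ = x ⁴ ²

  -- T x stands for: x E₁₁ is a sum of eighth powers of 2 × 2 matrices. The polynomials in the last two hypotheses are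
  -- the traces of C⁸ when C has trace 0 and determinant - d, and when C has trace 1 and determinant d.
  module _ {p} (T : Carrier → Set p)
    (T-resp : ∀ {x y} → x ≈ y → T x → T y)
    (T-+ : ∀ {x y} → T x → T y → T (x + y))
    (T-8 : ∀ x → T (x ⁸))
    (T-neg8 : ∀ x → T (- x ⁸))
    (T-trace₀ : ∀ d → T (ι (+ 2) * d ⁴))
    (T-trace₁ : ∀ d → T (1# - ι (+ 8) * d + ι (+ 20) * d ² - ι (+ 16) * (d * d ²) + ι (+ 2) * d ⁴))
    where

    T-0 : T 0#
    T-0 = T-resp (trans (*-congʳ (trans (*-congʳ (zeroˡ 0#)) (zeroˡ (0# * 0#)))) (zeroˡ (0# ⁴))) (T-8 0#)

    T-· : ∀ n {x} → T x → T (ι (+ n) * x)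
    T-· zero    {x} t = T-resp (sym (zeroˡ x)) T-0
    T-· (suc n) {x} t = T-resp
      (trans (+-congʳ (sym (*-identityˡ x))) (trans (sym (distribʳ x 1# (n · 1#))) (*-congʳ (sym (1+× n 1#)))))
      (T-+ t (T-· n t))

    -- Closure of `T` under negation is only reached in `T-neg`; until then both signs are carried
    -- along.
    D : Carrier → Set p
    D x = T x × T (- x)

    D-resp : ∀ {x y} → x ≈ y → D x → D y
    D-resp e (t , u) = T-resp e t , T-resp (-‿cong e) u

    D-+ : ∀ {x y} → D x → D y → D (x + y)
    D-+ {x} {y} (t , u) (t′ , u′) = T-+ t t′ , T-resp (solve 2 (λ x y → :- x :+ :- y := :- (x :+ y)) refl x y) (T-+ u u′)

    D-neg : ∀ {x} → D x → D (- x)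
    D-neg {x} (t , u) = u , T-resp (sym (⁻¹-involutive x)) t

    D-· : ∀ n {x} → D x → D (ι (+ n) * x)
    D-· n {x} (t , u) = T-· n t , T-resp (solve 2 (λ n x → n :* :- x := :- (n :* x)) refl (ι (+ n)) x) (T-· n u)

    D-8 : ∀ x → D (x ⁸)
    D-8 x = T-8 x , T-neg8 x

    -- F (x + 1) + F (x - 1) - 2 F x leaves the even powers of x, and F (2 x) - 2 ^ k F x removes x ^ k.
    D₁ : ∀ x → D (ι (+ 56) * (x ² * x ⁴) + ι (+ 140) * x ⁴ + ι (+ 56) * x ²)
    D₁ x = D-resp
      (solve 1 (λ x →
          let sq = λ y → y :* y ; e8 = λ y → sq (sq (sq y)) ; one = con (+ 1) in
          (e8 (x :+ one) :+ e8 (x :+ :- one)) :+ :- (con (+ 2) :* (e8 x :+ e8 one))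
          := con (+ 56) :* (sq x :* sq (sq x)) :+ con (+ 140) :* sq (sq x) :+ con (+ 56) :* sq x) refl x)
      (D-+ (D-+ (D-8 (x + 1#)) (D-8 (x + - 1#))) (D-neg (D-· 2 (D-+ (D-8 x) (D-8 1#)))))

    D₂ : ∀ x → D (- (ι (+ 6720) * x ⁴ + ι (+ 3360) * x ²))
    D₂ x = D-resp
      (solve 1 (λ x →
          let sq = λ y → y :* y
              F = λ y → con (+ 56) :* (sq y :* sq (sq y)) :+ con (+ 140) :* sq (sq y) :+ con (+ 56) :* sq y in
          F (con (+ 2) :* x) :+ :- (con (+ 64) :* F x)
          := :- (con (+ 6720) :* sq (sq x) :+ con (+ 3360) :* sq x)) refl x)
      (D-+ (D₁ (ι (+ 2) * x)) (D-neg (D-· 64 (D₁ x))))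

    D₃ : ∀ x → D (ι (+ 40320) * x ²)
    D₃ x = D-resp
      (solve 1 (λ x →
          let sq = λ y → y :* y
              F = λ y → :- (con (+ 6720) :* sq (sq y) :+ con (+ 3360) :* sq y) in
          F (con (+ 2) :* x) :+ :- (con (+ 16) :* F x) := con (+ 40320) :* sq x) refl x)
      (D-+ (D₂ (ι (+ 2) * x)) (D-neg (D-· 16 (D₂ x))))

    -- Polarising the square with second argument 1 makes the expression linear; the constant is
    -- `2 · 8!`.
    D₄ : ∀ x → D (ι (+ 80640) * x)
    D₄ x = D-resp
      (solve 1 (λ x →
          let F = λ y → con (+ 40320) :* (y :* y) ; one = con (+ 1) in
          F (x :+ one) :+ :- (F x :+ F one) := con (+ 80640) :* x) refl x)
      (D-+ (D₃ (x + 1#)) (D-neg (D-+ (D₃ x) (D₃ 1#))))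

    -- Since `T` contains all multiples of `80640`, adding `80639` copies of `x` amounts to
    -- subtracting `x`.
    T-neg : ∀ {x} → T x → T (- x)
    T-neg {x} t = T-resp
      (solve 1 (λ x → con (+ 80640) :* :- x :+ con (+ 80639) :* x := :- x) refl x)
      (T-+ (proj₁ (D₄ (- x))) (T-· 80639 t))

    T-minus : ∀ {x y} → T x → T y → T (x - y)
    T-minus t u = T-+ t (T-neg u)

    -- The polynomial of `T-trace₁` without its constant and quartic terms, which satisfy `T` by
    -- themselves.
    f : Carrier → Carrier
    f d = - (ι (+ 8) * d) + ι (+ 20) * d ² - ι (+ 16) * (d * d ²)

    fᴾ : ∀ {n} → Polynomial n → Polynomial n
    fᴾ d = :- (con (+ 8) :* d) :+ con (+ 20) :* (d :* d) :- con (+ 16) :* (d :* (d :* d))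

    T-f : ∀ d → T (f d)
    T-f d = T-resp
      (solve 1 (λ d →
          let sq = λ y → y :* y ; one = con (+ 1) in
          (one :- con (+ 8) :* d :+ con (+ 20) :* sq d :- con (+ 16) :* (d :* sq d) :+ con (+ 2) :* sq (sq d))
            :- (con (+ 2) :* sq (sq d) :+ sq (sq (sq one))) := fᴾ d) refl d)
      (T-minus (T-trace₁ d) (T-+ (T-trace₀ d) (T-8 1#)))

    T-40 : ∀ d → T (ι (+ 40) * d ²)
    T-40 d = T-resp (solve 1 (λ d → fᴾ d :+ fᴾ (:- d) := con (+ 40) :* (d :* d)) refl d) (T-+ (T-f d) (T-f (- d)))

    -- The difference `f (d + 1) - f d - f 1` equals `- 8 d - 48 d²`, and `40 d²` is already
    -- available.
    T-8+8 : ∀ d → T (ι (+ 8) * d + ι (+ 8) * d ²)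
    T-8+8 d = T-resp
      (solve 1 (λ d → :- (fᴾ (d :+ con (+ 1)) :- (fᴾ d :+ fᴾ (con (+ 1)))) :- con (+ 40) :* (d :* d)
          := con (+ 8) :* d :+ con (+ 8) :* (d :* d)) refl d)
      (T-minus (T-neg (T-minus (T-f (d + 1#)) (T-+ (T-f d) (T-f 1#)))) (T-40 d))

    T-16* : ∀ d → T (ι (+ 16) * d)
    T-16* d = T-resp
      (solve 1 (λ d →
          let g = λ y → con (+ 8) :* y :+ con (+ 8) :* (y :* y) ; one = con (+ 1) in
          g (d :+ one) :- (g d :+ g one) := con (+ 16) :* d) refl d)
      (T-minus (T-8+8 (d + 1#)) (T-+ (T-8+8 d) (T-8+8 1#)))

    -- Five times `8 d + 8 d²` without `40 d²` is `40 d`, and `40 - 2 · 16 = 8`.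
    T-8* : ∀ d → T (ι (+ 8) * d)
    T-8* d = T-resp
      (solve 1 (λ d →
          (con (+ 5) :* (con (+ 8) :* d :+ con (+ 8) :* (d :* d)) :- con (+ 40) :* (d :* d)) :- con (+ 2) :* (con (+ 16) :* d)
          := con (+ 8) :* d) refl d)
      (T-minus (T-minus (T-· 5 (T-8+8 d)) (T-40 d)) (T-· 2 (T-16* d)))

    -- Modulo multiples of 8, only `20 d²` survives in `f d`, and 20 is 4 modulo 8.
    T-4² : ∀ d → T (ι (+ 4) * d ²)
    T-4² d = T-resp
      (solve 1 (λ d →
          fᴾ d :+ con (+ 8) :* (d :- con (+ 2) :* (d :* d) :+ con (+ 2) :* (d :* (d :* d))) := con (+ 4) :* (d :* d)) refl d)
      (T-+ (T-f d) (T-8* (d - ι (+ 2) * d ² + ι (+ 2) * (d * d ²))))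

    module _ (perfect : ∀ x → ∃₂ λ y z → x ≈ y ² + ι (+ 2) * z) where

      T-4* : ∀ x → T (ι (+ 4) * x)
      T-4* x with perfect x
      ... | y , z , e = T-resp
        (trans (solve 2 (λ y z → con (+ 4) :* (y :* y) :+ con (+ 8) :* z := con (+ 4) :* (y :* y :+ con (+ 2) :* z)) refl y z)
          (*-congˡ (sym e)))
        (T-+ (T-4² y) (T-8* z))

      -- If `y` is a square modulo 2, then `y²` is a fourth power modulo 2; `eighth` repeats the
      -- argument.
      fourth : ∀ x → ∃₂ λ y z → x ≈ y ⁴ + ι (+ 2) * z
      fourth x with perfect x
      ... | y , z , e with perfect y
      ... | u , v , e′ = u , ι (+ 2) * (u ² * v) + ι (+ 2) * v ² + z , trans e (trans (+-congʳ (*-cong e′ e′))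
        (solve 3 (λ u v z →
          let sq = λ y → y :* y in
          sq (sq u :+ con (+ 2) :* v) :+ con (+ 2) :* z
          := sq (sq u) :+ con (+ 2) :* (con (+ 2) :* (sq u :* v) :+ con (+ 2) :* sq v :+ z)) refl u v z))

      eighth : ∀ x → ∃₂ λ y z → x ≈ y ⁸ + ι (+ 2) * z
      eighth x with fourth x
      ... | y , z , e with perfect y
      ... | u , v , e′ = u ,
        -- Half of `(u² + 2 v)⁴ - u⁸`, plus `z`.
        ι (+ 4) * (u ² * u ⁴ * v) + ι (+ 12) * (u ⁴ * v ²) + ι (+ 16) * (u ² * (v * v ²)) + ι (+ 8) * v ⁴ + z ,
        trans e (trans (+-congʳ (*-cong (*-cong e′ e′) (*-cong e′ e′)))
        (solve 3 (λ u v z →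
          let sq = λ y → y :* y in
          sq (sq (sq u :+ con (+ 2) :* v)) :+ con (+ 2) :* z
          := sq (sq (sq u)) :+ con (+ 2) :* (con (+ 4) :* (sq u :* sq (sq u) :* v) :+ con (+ 12) :* (sq (sq u) :* sq v)
               :+ con (+ 16) :* (sq u :* (v :* sq v)) :+ con (+ 8) :* sq (sq v) :+ z)) refl u v z))

      T-2*⁴ : ∀ y z → T (ι (+ 2) * (y ⁴ + ι (+ 2) * z))
      T-2*⁴ y z = T-resp
        (solve 2 (λ a z → con (+ 2) :* a :+ con (+ 4) :* z := con (+ 2) :* (a :+ con (+ 2) :* z)) refl (y ⁴) z)
        (T-+ (T-trace₀ y) (T-4* z))

      T-2* : ∀ x → T (ι (+ 2) * x)
      T-2* x = let y , z , e = fourth x in T-resp (*-congˡ (sym e)) (T-2*⁴ y z)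

      T-all : ∀ x → T x
      T-all x = let y , z , e = eighth x in T-resp (sym e) (T-+ (T-8 y) (T-2* z))

-- Two-by-two matrices as sums of eighth powers.

module TwoByTwo {c ℓ} (R : CommutativeRing c ℓ) where

  open import Data.Integer using (+_)
  open import Data.Product using (∃₂)

  open CommutativeRing R
  open IntegerCoefficients R
  open Solver
  open EighthPowerTargets R

  record M₂ : Set c where
    constructor mat
    field
      m₁₁ m₁₂ m₂₁ m₂₂ : Carrier

  record _≈₂_ (A B : M₂) : Set ℓ where
    constructor eqs
    private
      module A = M₂ A
      module B = M₂ B
    field
      e₁₁ : A.m₁₁ ≈ B.m₁₁
      e₁₂ : A.m₁₂ ≈ B.m₁₂
      e₂₁ : A.m₂₁ ≈ B.m₂₁
      e₂₂ : A.m₂₂ ≈ B.m₂₂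

  infix  4 _≈₂_
  infixl 6 _+₂_
  infixl 7 _*₂_

  _+₂_ _*₂_ : M₂ → M₂ → M₂
  mat a b c d +₂ mat a′ b′ c′ d′ = mat (a + a′) (b + b′) (c + c′) (d + d′)
  mat a b c d *₂ mat a′ b′ c′ d′ =
    mat (a * a′ + b * c′) (a * b′ + b * d′) (c * a′ + d * c′) (c * b′ + d * d′)

  pow8₂ : M₂ → M₂
  pow8₂ A = let A² = A *₂ A ; A⁴ = A² *₂ A² in A⁴ *₂ A⁴

  ≈₂-trans : ∀ {A B C} → A ≈₂ B → B ≈₂ C → A ≈₂ C
  ≈₂-trans (eqs p q r s) (eqs p′ q′ r′ s′) = eqs (trans p p′) (trans q q′) (trans r r′) (trans s s′)

  *₂-cong : ∀ {A B C D} → A ≈₂ B → C ≈₂ D → A *₂ C ≈₂ B *₂ D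
  *₂-cong (eqs p q r s) (eqs p′ q′ r′ s′) = eqs
    (+-cong (*-cong p p′) (*-cong q r′)) (+-cong (*-cong p q′) (*-cong q s′))
    (+-cong (*-cong r p′) (*-cong s r′)) (+-cong (*-cong r q′) (*-cong s s′))

  -- Three squarings with simple intermediate results replace the expansion of a full eighth power.
  pow8₂-via : ∀ {A B C D} → A *₂ A ≈₂ B → B *₂ B ≈₂ C → C *₂ C ≈₂ D → pow8₂ A ≈₂ D
  pow8₂-via e f g = ≈₂-trans (*₂-cong e⁴ e⁴) g
    where e⁴ = ≈₂-trans (*₂-cong e e) f

  module _ {p} (S : M₂ → Set p)
    (S-resp : ∀ {A B} → A ≈₂ B → S A → S B)
    (S-+ : ∀ {A B} → S A → S B → S (A +₂ B))
    (S-8 : ∀ A → S (pow8₂ A))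
    (perfect : ∀ x → ∃₂ λ y z → x ≈ y ² + ι (+ 2) * z)
    where

    S-idem : ∀ {A} → A *₂ A ≈₂ A → S A
    S-idem {A} e = S-resp (pow8₂-via e e e) (S-8 A)

    Z I : ∀ {n} → Polynomial n
    Z = con (+ 0)
    I = con (+ 1)

    S-F : ∀ a → S (mat 1# a 0# 0#)
    S-F a = S-idem (eqs
      (solve 1 (λ a → I :* I :+ a :* Z := I) refl a) (solve 1 (λ a → I :* a :+ a :* Z := a) refl a)
      (solve 0 (Z :* I :+ Z :* Z := Z) refl) (solve 1 (λ a → Z :* a :+ Z :* Z := Z) refl a))

    S-F′ : ∀ a → S (mat 1# 0# a 0#)
    S-F′ a = S-idem (eqs
      (solve 1 (λ a → I :* I :+ Z :* a := I) refl a) (solve 0 (I :* Z :+ Z :* Z := Z) refl)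
      (solve 1 (λ a → a :* I :+ Z :* a := a) refl a) (solve 1 (λ a → a :* Z :+ Z :* Z := Z) refl a))

    S-E₂₂ : S (mat 0# 0# 0# 1#)
    S-E₂₂ = S-idem (eqs
      (solve 0 (Z :* Z :+ Z :* Z := Z) refl) (solve 0 (Z :* Z :+ Z :* I := Z) refl)
      (solve 0 (Z :* Z :+ I :* Z := Z) refl) (solve 0 (Z :* Z :+ I :* I := I) refl))

    -- x C and x C², where C = ((0, -1), (1, -1)) has order 3: since 1 + C + C² = 0 their eighth powers
    -- x⁸ C² and x⁸ C add up to - x⁸.
    S-neg8 : ∀ x → S (mat (- x ⁸) 0# 0# (- x ⁸))
    S-neg8 x = S-resp
      (eqs (solve 1 (λ x → :- e8 x :+ Z := :- e8 x) refl x) (solve 1 (λ x → e8 x :+ :- e8 x := Z) refl x)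
           (solve 1 (λ x → :- e8 x :+ e8 x := Z) refl x) (solve 1 (λ x → Z :+ :- e8 x := :- e8 x) refl x))
      (S-+ (S-resp (pow8₂-via (C*C x) (C²*C² (x ²)) (C*C (x ⁴))) (S-8 (C x)))
           (S-resp (pow8₂-via (C²*C² x) (C*C (x ²)) (C²*C² (x ⁴))) (S-8 (C² x))))
      where
      e8 : ∀ {n} → Polynomial n → Polynomial n
      e8 x = let x² = x :* x ; x⁴ = x² :* x² in x⁴ :* x⁴
      C C² : Carrier → M₂
      C  x = mat 0# (- x) x (- x)
      C² x = mat (- x) x (- x) 0#
      C*C : ∀ x → C x *₂ C x ≈₂ C² (x ²)
      C*C x = eqs
        (solve 1 (λ x → Z :* Z :+ :- x :* x := :- (x :* x)) refl x)
        (solve 1 (λ x → Z :* :- x :+ :- x :* :- x := x :* x) refl x)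
        (solve 1 (λ x → x :* Z :+ :- x :* x := :- (x :* x)) refl x)
        (solve 1 (λ x → x :* :- x :+ :- x :* :- x := Z) refl x)
      C²*C² : ∀ x → C² x *₂ C² x ≈₂ C (x ²)
      C²*C² x = eqs
        (solve 1 (λ x → :- x :* :- x :+ x :* :- x := Z) refl x)
        (solve 1 (λ x → :- x :* x :+ x :* Z := :- (x :* x)) refl x)
        (solve 1 (λ x → :- x :* :- x :+ Z :* :- x := x :* x) refl x)
        (solve 1 (λ x → :- x :* x :+ Z :* Z := :- (x :* x)) refl x)

    S-neg1 : S (mat (- 1#) 0# 0# (- 1#))
    S-neg1 = S-resp (eqs e refl refl e) (S-neg8 1#)
      where e = solve 0 (:- ((I :* I :* (I :* I)) :* (I :* I :* (I :* I))) := :- I) refl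

    -- The idempotents `((1, a), (0, 0))` and `E₂₂` add up to the identity plus `a E₁₂`; `S-neg1`
    -- removes the identity.
    S-E₁₂ : ∀ a → S (mat 0# a 0# 0#)
    S-E₁₂ a = S-resp
      (eqs (solve 0 (I :+ (:- I :+ Z) := Z) refl) (solve 1 (λ a → a :+ (Z :+ Z) := a) refl a)
           (solve 0 (Z :+ (Z :+ Z) := Z) refl) (solve 0 (Z :+ (:- I :+ I) := Z) refl))
      (S-+ (S-F a) (S-+ S-neg1 S-E₂₂))

    S-E₂₁ : ∀ a → S (mat 0# 0# a 0#)
    S-E₂₁ a = S-resp
      (eqs (solve 0 (I :+ (:- I :+ Z) := Z) refl) (solve 0 (Z :+ (Z :+ Z) := Z) refl)
           (solve 1 (λ a → a :+ (Z :+ Z) := a) refl a) (solve 0 (Z :+ (:- I :+ I) := Z) refl))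
      (S-+ (S-F′ a) (S-+ S-neg1 S-E₂₂))

    -- Multiples of `E₁₂` and `E₂₁` can be added freely, so from here on only diagonals have to be
    -- tracked.
    S-off : ∀ {a b c d} b′ c′ → S (mat a b c d) → S (mat a b′ c′ d)
    S-off {a} {b} {c} {d} b′ c′ s = S-resp
      (eqs (solve 1 (λ a → a :+ (Z :+ Z) := a) refl a) (solve 2 (λ b b′ → b :+ (b′ :+ :- b :+ Z) := b′) refl b b′)
           (solve 2 (λ c c′ → c :+ (Z :+ (c′ :+ :- c)) := c′) refl c c′) (solve 1 (λ d → d :+ (Z :+ Z) := d) refl d))
      (S-+ s (S-+ (S-E₁₂ (b′ + - b)) (S-E₂₁ (c′ + - c))))

    -- ((s, s), (-s, -s)) is conjugate to s E₁₂ and hence, like that, a sum of two idempotents and - 1.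
    S-traceless : ∀ s → S (mat s 0# 0# (- s))
    S-traceless s = S-off 0# 0# (S-resp
      (eqs (solve 1 (λ s → (I :+ s) :+ (Z :+ :- I) := s) refl s) (solve 1 (λ s → s :+ (Z :+ Z) := s) refl s)
           (solve 1 (λ s → :- (I :+ s) :+ (I :+ Z) := :- s) refl s) (solve 1 (λ s → :- s :+ (I :+ :- I) := :- s) refl s))
      (S-+ F (S-+ E′ S-neg1)))
      where
      F : S (mat (1# + s) s (- (1# + s)) (- s))
      F = S-idem (eqs
        (solve 1 (λ s → (I :+ s) :* (I :+ s) :+ s :* :- (I :+ s) := I :+ s) refl s)
        (solve 1 (λ s → (I :+ s) :* s :+ s :* :- s := s) refl s)
        (solve 1 (λ s → :- (I :+ s) :* (I :+ s) :+ :- s :* :- (I :+ s) := :- (I :+ s)) refl s)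
        (solve 1 (λ s → :- (I :+ s) :* s :+ :- s :* :- s := :- s) refl s))
      E′ : S (mat 0# 0# 1# 1#)
      E′ = S-idem (eqs
        (solve 0 (Z :* Z :+ Z :* I := Z) refl) (solve 0 (Z :* Z :+ Z :* I := Z) refl)
        (solve 0 (I :* Z :+ I :* I := I) refl) (solve 0 (I :* Z :+ I :* I := I) refl))

    T : Carrier → Set p
    T x = S (mat x 0# 0# 0#)

    -- Adding the traceless matrix with diagonal `d`, `- d` moves the lower diagonal entry into the
    -- corner.
    T-trace : ∀ {a b c d} → S (mat a b c d) → T (a + d)
    T-trace {a} {b} {c} {d} s = S-off 0# 0# (S-resp
      (eqs refl refl refl (-‿inverseʳ d)) (S-+ s (S-traceless d)))

    T-+ : ∀ {x y} → T x → T y → T (x + y)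
    T-+ t u = S-off 0# 0# (S-resp (eqs refl refl refl (+-identityʳ 0#)) (S-+ t u))

    S-diagonal : ∀ x → S (mat (x ⁸) 0# 0# 0#)
    S-diagonal x = S-resp (pow8₂-via (sq x) (sq (x ²)) (sq (x ⁴))) (S-8 (mat x 0# 0# 0#))
      where
      sq : ∀ x → mat x 0# 0# 0# *₂ mat x 0# 0# 0# ≈₂ mat (x ²) 0# 0# 0#
      sq x = eqs (solve 1 (λ x → x :* x :+ Z :* Z := x :* x) refl x) (solve 1 (λ x → x :* Z :+ Z :* Z := Z) refl x)
        (solve 1 (λ x → Z :* x :+ Z :* Z := Z) refl x) (solve 0 (Z :* Z :+ Z :* Z := Z) refl)

    -- The scalar matrix `- x⁸` has trace `- 2 x⁸`; one copy of `x⁸` corrects this.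
    T-neg8 : ∀ x → T (- x ⁸)
    T-neg8 x = T-resp
      (solve 1 (λ y → (:- y :+ :- y) :+ y := :- y) refl (x ⁸))
      (T-+ (T-trace (S-neg8 x)) (S-diagonal x))
      where
      T-resp : ∀ {x y} → x ≈ y → T x → T y
      T-resp e = S-resp (eqs e refl refl refl)

    -- The matrix `((0, d), (1, 0))` squares to the scalar `d`, so its eighth power is the scalar
    -- `d⁴`.
    T-trace₀ : ∀ d → T (ι (+ 2) * d ⁴)
    T-trace₀ d = S-resp
      (eqs (solve 1 (λ y → y :+ y := con (+ 2) :* y) refl (d ⁴)) refl refl refl)
      (T-trace (S-resp (pow8₂-via {mat 0# d 1# 0#}
        (eqs (solve 1 (λ d → Z :* Z :+ d :* I := d) refl d) (solve 1 (λ d → Z :* d :+ d :* Z := Z) refl d)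
             (solve 0 (I :* Z :+ Z :* I := Z) refl) (solve 1 (λ d → I :* d :+ Z :* Z := d) refl d))
        (scalar d) (scalar (d ²))) (S-8 (mat 0# d 1# 0#))))
      where
      scalar : ∀ x → mat x 0# 0# x *₂ mat x 0# 0# x ≈₂ mat (x ²) 0# 0# (x ²)
      scalar x = eqs (solve 1 (λ x → x :* x :+ Z :* Z := x :* x) refl x) (solve 1 (λ x → x :* Z :+ Z :* x := Z) refl x)
        (solve 1 (λ x → Z :* x :+ x :* Z := Z) refl x) (solve 1 (λ x → Z :* Z :+ x :* x := x :* x) refl x)

    -- The powers of a matrix C with trace 1 and determinant d stay in the span of 1 and C: C² = C - d.
    companion : Carrier → Carrier → Carrier → M₂
    companion d u v = mat v (- (u * d)) u (u + v)

    -- This is the square of `u C + v`, reduced by `C² = C - d`.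
    companion-square : ∀ d u v → companion d u v *₂ companion d u v ≈₂
      companion d (u ² + ι (+ 2) * (u * v)) (v ² - u ² * d)
    companion-square d u v = eqs
      (solve 3 (λ d u v → v :* v :+ :- (u :* d) :* u := v :* v :- u :* u :* d) refl d u v)
      (solve 3 (λ d u v → v :* :- (u :* d) :+ :- (u :* d) :* (u :+ v) := :- ((u :* u :+ con (+ 2) :* (u :* v)) :* d)) refl d u v)
      (solve 3 (λ d u v → u :* v :+ (u :+ v) :* u := u :* u :+ con (+ 2) :* (u :* v)) refl d u v)
      (solve 3 (λ d u v → u :* :- (u :* d) :+ (u :+ v) :* (u :+ v)
          := (u :* u :+ con (+ 2) :* (u :* v)) :+ (v :* v :- u :* u :* d)) refl d u v)

    T-trace₁ : ∀ d → T (1# - ι (+ 8) * d + ι (+ 20) * d ² - ι (+ 16) * (d * d ²) + ι (+ 2) * d ⁴)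
    T-trace₁ d = S-resp
      -- `U` and `V` are the coordinate recursions of `companion-square`, applied three times
      -- starting from `(1, 0)`; the trace of `u C + v` is `u + 2 v`.
      (eqs (solve 1 (λ d →
          let sq = λ y → y :* y
              U = λ u v → sq u :+ con (+ 2) :* (u :* v)
              V = λ u v → sq v :- sq u :* d
              u₁ = U I Z ; v₁ = V I Z ; u₂ = U u₁ v₁ ; v₂ = V u₁ v₁ in
          V u₂ v₂ :+ (U u₂ v₂ :+ V u₂ v₂)
          := I :- con (+ 8) :* d :+ con (+ 20) :* sq d :- con (+ 16) :* (d :* sq d) :+ con (+ 2) :* sq (sq d)) refl d)
        refl refl refl)
      (T-trace (S-resp (pow8₂-via (companion-square d 1# 0#)
        (companion-square d _ _) (companion-square d _ _)) (S-8 (companion d 1# 0#))))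

    T-all′ : ∀ x → T x
    T-all′ = T-all T (λ e → S-resp (eqs e refl refl refl)) T-+ S-diagonal T-neg8 T-trace₀ T-trace₁ perfect

    S-all : ∀ A → S A
    S-all (mat a b c d) = S-off b c (S-resp
      (eqs (solve 2 (λ a d → (a :+ d) :+ :- d := a) refl a d) (+-identityʳ 0#) (+-identityʳ 0#)
           (solve 1 (λ d → Z :+ :- :- d := d) refl d))
      (S-+ (T-all′ (a + d)) (S-traceless (- d))))

-- Matrices of any size at least two, assembled from two-by-two blocks.

module SquareMatrices {c ℓ} (R : CommutativeRing c ℓ) where

  open import Data.Fin using (Fin; zero; suc; _≟_)
  open import Data.Integer using (+_)
  open import Data.Nat using (ℕ; zero; suc)
  open import Data.Product using (∃; ∃₂; _,_)
  open import Relation.Binary.PropositionalEquality using (_≡_; _≢_)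
  import Relation.Binary.PropositionalEquality as ≡
  open import Relation.Nullary using (yes; no; contradiction)
  import Algebra.Properties.Semiring.Sum
  import Relation.Binary.Reasoning.Setoid as SetoidReasoning

  open CommutativeRing R hiding (zero)
  open IntegerCoefficients R using (ι; module Solver)
  open Solver
  open EighthPowerTargets R using (_²)
  open TwoByTwo R
  open Algebra.Properties.Semiring.Sum semiring
  open SetoidReasoning setoid

  Matrix : ℕ → Set c
  Matrix n = Fin n → Fin n → Carrier

  infix  4 _≋_
  infixl 6 _⊞_
  infixl 7 _⊠_

  _≋_ : ∀ {n} → Matrix n → Matrix n → Set ℓ
  A ≋ B = ∀ r s → A r s ≈ B r s

  _⊞_ _⊠_ : ∀ {n} → Matrix n → Matrix n → Matrix n
  (A ⊞ B) r s = A r s + B r s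
  (A ⊠ B) r s = sum (λ l → A r l * B l s)

  pow8 : ∀ {n} → Matrix n → Matrix n
  pow8 A = let A² = A ⊠ A ; A⁴ = A² ⊠ A² in A⁴ ⊠ A⁴

  ≋-trans : ∀ {n} {A B C : Matrix n} → A ≋ B → B ≋ C → A ≋ C
  ≋-trans e f r s = trans (e r s) (f r s)

  ⊠-cong : ∀ {n} {A B C D : Matrix n} → A ≋ B → C ≋ D → A ⊠ C ≋ B ⊠ D
  ⊠-cong e f r s = sum-cong-≋ (λ l → *-cong (e r l) (f l s))

  δ : ∀ {n} → Fin n → Fin n → Carrier
  δ zero    zero    = 1#
  δ zero    (suc j) = 0#
  δ (suc i) zero    = 0#
  δ (suc i) (suc j) = δ i j

  δ-sym : ∀ {n} (i j : Fin n) → δ i j ≡ δ j i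
  δ-sym zero    zero    = ≡.refl
  δ-sym zero    (suc j) = ≡.refl
  δ-sym (suc i) zero    = ≡.refl
  δ-sym (suc i) (suc j) = δ-sym i j

  δ-refl : ∀ {n} (i : Fin n) → δ i i ≡ 1#
  δ-refl zero    = ≡.refl
  δ-refl (suc i) = δ-refl i

  δ-distinct : ∀ {n} {i j : Fin n} → i ≢ j → δ i j ≡ 0#
  δ-distinct {i = zero}  {zero}  i≢j = contradiction ≡.refl i≢j
  δ-distinct {i = zero}  {suc j} i≢j = ≡.refl
  δ-distinct {i = suc i} {zero}  i≢j = ≡.refl
  δ-distinct {i = suc i} {suc j} i≢j = δ-distinct (λ e → i≢j (≡.cong suc e))

  sum-zero : ∀ {n} {f : Fin n → Carrier} → (∀ l → f l ≈ 0#) → sum f ≈ 0#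
  sum-zero {n} e = trans (sum-cong-≋ e) (sum-replicate-zero n)

  sum-δ : ∀ {n} (i : Fin n) f → sum (λ l → δ i l * f l) ≈ f i
  sum-δ zero    f = trans (+-cong (*-identityˡ (f zero)) (sum-zero (λ l → zeroˡ (f (suc l))))) (+-identityʳ (f zero))
  sum-δ (suc i) f = trans (+-cong (zeroˡ (f zero)) (sum-δ i (λ l → f (suc l)))) (+-identityˡ (f (suc i)))

  -- For distinct `i` and `j` this is the block in rows and columns `i` and `j`, with zeros
  -- elsewhere.
  embed : ∀ {n} → Fin n → Fin n → M₂ → Matrix n
  embed i j (mat a b c d) r s = (δ i r * a + δ j r * c) * δ i s + (δ i r * b + δ j r * d) * δ j s

  embed-cong : ∀ {n} (i j : Fin n) {A B} → A ≈₂ B → embed i j A ≋ embed i j B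
  embed-cong i j (eqs p q r s) k l = +-cong
    (*-congʳ (+-cong (*-congˡ p) (*-congˡ r))) (*-congʳ (+-cong (*-congˡ q) (*-congˡ s)))

  embed-+ : ∀ {n} (i j : Fin n) A B → embed i j A ⊞ embed i j B ≋ embed i j (A +₂ B)
  embed-+ i j (mat a b c d) (mat a′ b′ c′ d′) r s = trans
    (solve 6 (λ P Q P′ Q′ x y → (P :* x :+ Q :* y) :+ (P′ :* x :+ Q′ :* y) := (P :+ P′) :* x :+ (Q :+ Q′) :* y) refl
      (δ i r * a + δ j r * c) (δ i r * b + δ j r * d) (δ i r * a′ + δ j r * c′) (δ i r * b′ + δ j r * d′) (δ i s) (δ j s))
    (+-cong (*-congʳ (merge a c a′ c′)) (*-congʳ (merge b d b′ d′)))
    where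
    merge : ∀ a c a′ c′ → (δ i r * a + δ j r * c) + (δ i r * a′ + δ j r * c′) ≈ δ i r * (a + a′) + δ j r * (c + c′)
    merge a c a′ c′ = solve 6 (λ x y a c a′ c′ → (x :* a :+ y :* c) :+ (x :* a′ :+ y :* c′) := x :* (a :+ a′) :+ y :* (c :+ c′))
      refl (δ i r) (δ j r) a c a′ c′

  -- The inner summation only meets `i` and `j`. As these differ, the right factor contributes
  -- exactly the two rows of its block.
  embed-* : ∀ {n} {i j : Fin n} → i ≢ j → ∀ A B → embed i j A ⊠ embed i j B ≋ embed i j (A *₂ B)
  embed-* {n} {i} {j} i≢j A@(mat a b c d) B@(mat a′ b′ c′ d′) r s = begin
    sum (λ l → (α * δ i l + β * δ j l) * X l)
      ≈⟨ sum-cong-≋ (λ l → solve 5 (λ α β x y X → (α :* x :+ β :* y) :* X := α :* (x :* X) :+ β :* (y :* X))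
           refl α β (δ i l) (δ j l) (X l)) ⟩
    sum (λ l → α * (δ i l * X l) + β * (δ j l * X l))
      ≈⟨ ∑-distrib-+ (λ l → α * (δ i l * X l)) (λ l → β * (δ j l * X l)) ⟩
    sum (λ l → α * (δ i l * X l)) + sum (λ l → β * (δ j l * X l))
      ≈⟨ +-cong (sym (*-distribˡ-sum α (λ l → δ i l * X l))) (sym (*-distribˡ-sum β (λ l → δ j l * X l))) ⟩
    α * sum (λ l → δ i l * X l) + β * sum (λ l → δ j l * X l)
      ≈⟨ +-cong (*-congˡ (sum-δ i X)) (*-congˡ (sum-δ j X)) ⟩
    α * X i + β * X j
      ≈⟨ +-cong (*-congˡ X-i) (*-congˡ X-j) ⟩
    α * (a′ * δ i s + b′ * δ j s) + β * (c′ * δ i s + d′ * δ j s)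
      ≈⟨ solve 8 (λ α β a′ b′ c′ d′ x y → α :* (a′ :* x :+ b′ :* y) :+ β :* (c′ :* x :+ d′ :* y)
           := (α :* a′ :+ β :* c′) :* x :+ (α :* b′ :+ β :* d′) :* y) refl α β a′ b′ c′ d′ (δ i s) (δ j s) ⟩
    (α * a′ + β * c′) * δ i s + (α * b′ + β * d′) * δ j s
      ≈⟨ +-cong (*-congʳ (regroup a′ c′)) (*-congʳ (regroup b′ d′)) ⟩
    embed i j (A *₂ B) r s ∎
    where
    α β : Carrier
    α = δ i r * a + δ j r * c
    β = δ i r * b + δ j r * d
    X : Fin n → Carrier
    X l = embed i j B l s
    regroup : ∀ e f → α * e + β * f ≈ δ i r * (a * e + b * f) + δ j r * (c * e + d * f)
    regroup e f = solve 8 (λ x y a b c d e f → (x :* a :+ y :* c) :* e :+ (x :* b :+ y :* d) :* f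
      := x :* (a :* e :+ b :* f) :+ y :* (c :* e :+ d :* f)) refl (δ i r) (δ j r) a b c d e f
    row : ∀ {x y} → x ≈ 1# → y ≈ 0# → ∀ e f → x * e + y * f ≈ e
    row p q e f = trans (+-cong (trans (*-congʳ p) (*-identityˡ e)) (trans (*-congʳ q) (zeroˡ f))) (+-identityʳ e)
    row′ : ∀ {x y} → x ≈ 0# → y ≈ 1# → ∀ e f → x * e + y * f ≈ f
    row′ p q e f = trans (+-comm _ _) (row q p f e)
    X-i : X i ≈ a′ * δ i s + b′ * δ j s
    X-i = +-cong (*-congʳ (row (reflexive (δ-refl i)) (reflexive (δ-distinct (≡.≢-sym i≢j))) a′ c′))
                 (*-congʳ (row (reflexive (δ-refl i)) (reflexive (δ-distinct (≡.≢-sym i≢j))) b′ d′))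
    X-j : X j ≈ c′ * δ i s + d′ * δ j s
    X-j = +-cong (*-congʳ (row′ (reflexive (δ-distinct i≢j)) (reflexive (δ-refl j)) a′ c′))
                 (*-congʳ (row′ (reflexive (δ-distinct i≢j)) (reflexive (δ-refl j)) b′ d′))

  embed-pow8 : ∀ {n} {i j : Fin n} → i ≢ j → ∀ A → pow8 (embed i j A) ≋ embed i j (pow8₂ A)
  embed-pow8 {i = i} {j} i≢j A = ≋-trans (⊠-cong e⁴ e⁴) (embed-* i≢j A⁴ A⁴)
    where
    A² = A *₂ A
    A⁴ = A² *₂ A²
    e² : embed i j A ⊠ embed i j A ≋ embed i j A²
    e² = embed-* i≢j A A
    e⁴ : (embed i j A ⊠ embed i j A) ⊠ (embed i j A ⊠ embed i j A) ≋ embed i j A⁴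
    e⁴ = ≋-trans (⊠-cong e² e²) (embed-* i≢j A² A²)

  other : ∀ {n} (i : Fin (suc (suc n))) → ∃ λ j → i ≢ j
  other zero    = suc zero , λ ()
  other (suc i) = zero , λ ()

  module _ {p} {k : ℕ} (S : Matrix (suc (suc k)) → Set p)
    (S-resp : ∀ {A B} → A ≋ B → S A → S B)
    (S-+ : ∀ {A B} → S A → S B → S (A ⊞ B))
    (S-8 : ∀ A → S (pow8 A))
    (perfect : ∀ x → ∃₂ λ y z → x ≈ y ² + ι (+ 2) * z)
    where

    S-embed : ∀ {i j} → i ≢ j → ∀ A → S (embed i j A)
    S-embed {i} {j} i≢j = S-all (λ A → S (embed i j A))
      (λ e → S-resp (embed-cong i j e))
      (λ {A} {B} s t → S-resp (embed-+ i j A B) (S-+ s t))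
      (λ A → S-resp (embed-pow8 i≢j A) (S-8 (embed i j A)))
      perfect

    elementary : Fin (suc (suc k)) → Fin (suc (suc k)) → Carrier → Matrix (suc (suc k))
    elementary i j x r s = δ i r * (δ j s * x)

    -- An off-diagonal position lies in the block on `i` and `j`. A diagonal one needs a second
    -- index, which exists because the size is at least 2.
    S-elementary : ∀ i j x → S (elementary i j x)
    S-elementary i j x with i ≟ j
    ... | no i≢j = S-resp
      (λ r s → solve 5 (λ x ir jr is js → (ir :* con (+ 0) :+ jr :* con (+ 0)) :* is :+ (ir :* x :+ jr :* con (+ 0)) :* js
        := ir :* (js :* x)) refl x (δ i r) (δ j r) (δ i s) (δ j s))
      (S-embed i≢j (mat 0# x 0# 0#))
    ... | yes ≡.refl with other i
    ... | j′ , i≢j′ = S-resp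
      (λ r s → solve 5 (λ x ir jr is js → (ir :* x :+ jr :* con (+ 0)) :* is :+ (ir :* con (+ 0) :+ jr :* con (+ 0)) :* js
        := ir :* (is :* x)) refl x (δ i r) (δ j′ r) (δ i s) (δ j′ s))
      (S-embed i≢j′ (mat x 0# 0# 0#))

    S-sum : ∀ {n} (F : Fin n → Matrix (suc (suc k))) → (∀ l → S (F l)) → S (λ r s → sum (λ l → F l r s))
    -- The zero matrix satisfies `S` as the elementary matrix with entry 0.
    S-sum {zero}  F sF = S-resp (λ r s → trans (*-congˡ (zeroʳ _)) (zeroʳ _)) (S-elementary zero zero 0#)
    S-sum {suc n} F sF = S-+ (sF zero) (S-sum (λ l → F (suc l)) (λ l → sF (suc l)))

    S-matrix : ∀ M → S M
    S-matrix M = S-resp expand (S-sum _ (λ i → S-sum _ (λ j → S-elementary i j (M i j))))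
      where
      expand : (λ r s → sum (λ i → sum (λ j → elementary i j (M i j) r s))) ≋ M
      expand r s = begin
        sum (λ i → sum (λ j → δ i r * (δ j s * M i j)))
          ≈⟨ sum-cong-≋ (λ i → sym (*-distribˡ-sum (δ i r) (λ j → δ j s * M i j))) ⟩
        sum (λ i → δ i r * sum (λ j → δ j s * M i j))
          ≈⟨ sum-cong-≋ (λ i → *-cong (reflexive (δ-sym i r))
               (trans (sum-cong-≋ (λ j → *-congʳ {M i j} (reflexive (δ-sym j s)))) (sum-δ s (M i)))) ⟩
        sum (λ i → δ r i * M i s)
          ≈⟨ sum-δ r (λ i → M i s) ⟩
        M r s ∎

open import Defs

-- Parity of integers, sums and determinants.

module Parity where

  open BooleanDeterminant
  open BooleanAlgebras
  open import Data.Bool using (Bool; true; false; _∧_; _xor_)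
  open import Data.Bool.Properties
  open import Data.Fin using (Fin; zero; suc; punchIn)
  open import Data.Integer using (ℤ; +_; -[1+_]; _+_; _*_; -_; 1ℤ; ∣_∣)
  import Data.Integer.Properties as ℤ
  import Data.Integer.Solver as ℤ
  open import Data.Integer.GCD using (gcd)
  open import Data.Nat as ℕ using (ℕ; zero; suc; s≤s)
  import Data.Nat.Divisibility as ℕ
  import Data.Nat.GCD as ℕ
  import Data.Nat.Properties as ℕ
  open import Data.Product using (∃; _,_)
  open import Data.Sum using (_⊎_; inj₁; inj₂)
  open import Function using (_∘_; _⇔_; mk⇔)
  open import Relation.Binary.PropositionalEquality
  open import Relation.Nullary using (contradiction)

  -- As the canonical homomorphism to the two-element field, parity respects the ring operations by
  -- the general laws for `ι`.
  odd : ℤ → Bool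
  odd = IntegerCoefficients.ι xor-∧-commutativeRing

  odd-+ : ∀ i j → odd (i + j) ≡ odd i xor odd j
  odd-+ = IntegerCoefficients.ι-+ xor-∧-commutativeRing

  odd-* : ∀ i j → odd (i * j) ≡ odd i ∧ odd j
  odd-* = IntegerCoefficients.ι-* xor-∧-commutativeRing

  odd-neg : ∀ i → odd (- i) ≡ odd i
  odd-neg = IntegerCoefficients.ι-neg xor-∧-commutativeRing

  half : ∀ n → ∃ λ k → n ≡ 2 ℕ.* k ⊎ n ≡ suc (2 ℕ.* k)
  half zero    = 0 , inj₁ refl
  half (suc n) with half n
  ... | k , inj₁ e = k , inj₂ (cong suc e)
  ... | k , inj₂ e = suc k , inj₁ (trans (cong suc e) (cong suc (sym (ℕ.+-suc k (k ℕ.+ 0)))))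

  odd-double : ∀ z → odd (+ 2 * z) ≡ false
  odd-double z = odd-* (+ 2) z

  even-ℕ : ∀ n → odd (+ n) ≡ false → ∃ λ k → n ≡ 2 ℕ.* k
  even-ℕ n e with half n
  ... | k , inj₁ n≡2k = k , n≡2k
  ... | k , inj₂ n≡1+2k = contradiction (trans (sym e) (trans (cong (λ m → odd (+ m)) n≡1+2k)
    (trans (odd-+ 1ℤ (+ (2 ℕ.* k))) (cong (true xor_) (trans (cong odd (ℤ.pos-* 2 k)) (odd-double (+ k))))))) λ ()

  even : ∀ i → odd i ≡ false → ∃ λ z → i ≡ + 2 * z
  even (+ n) e with even-ℕ n e
  ... | k , n≡2k = + k , trans (cong +_ n≡2k) (ℤ.pos-* 2 k)
  even -[1+ n ] e with even-ℕ (suc n) (trans (sym (odd-neg (+ suc n))) e)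
  ... | k , n≡2k = - + k , trans (cong (λ m → - + m) n≡2k)
    (trans (cong -_ (ℤ.pos-* 2 k)) (ℤ.neg-distribʳ-* (+ 2) (+ k)))

  -- The greatest common divisor divides 2, hence is 1 or 2, and the value 2 would make `d` even.
  odd⇒coprime : ∀ d → odd d ≡ true → gcd (+ 2) d ≡ 1ℤ
  odd⇒coprime d o with ℕ.gcd 2 ∣ d ∣ | ℕ.gcd[m,n]∣m 2 ∣ d ∣ | ℕ.gcd[m,n]∣n 2 ∣ d ∣
  ... | g | g∣2 | g∣d with ℕ.∣⇒≤ g∣2
  odd⇒coprime d o | 0 | g∣2 | g∣d | _ = contradiction (ℕ.0∣⇒≡0 g∣2) λ ()
  odd⇒coprime d o | 1 | g∣2 | g∣d | _ = refl
  odd⇒coprime d o | 2 | g∣2 | g∣d | _ = contradiction (trans (sym o) (odd-abs d g∣d)) λ ()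
    where
    odd-multiple : ∀ {n} → 2 ℕ.∣ n → odd (+ n) ≡ false
    odd-multiple {n} (ℕ.divides q n≡q*2) = trans (cong (λ m → odd (+ m)) (trans n≡q*2 (ℕ.*-comm q 2)))
      (trans (cong odd (ℤ.pos-* 2 q)) (odd-double (+ q)))
    odd-abs : ∀ i → 2 ℕ.∣ ∣ i ∣ → odd i ≡ false
    odd-abs (+ n)    q = odd-multiple q
    odd-abs -[1+ n ] q = trans (odd-neg (+ suc n)) (odd-multiple q)
  odd⇒coprime d o | suc (suc (suc g)) | g∣2 | g∣d | s≤s (s≤s ())

  coprime⇒odd : ∀ d → gcd (+ 2) d ≡ 1ℤ → odd d ≡ true
  coprime⇒odd d c with odd d in o
  ... | true  = refl
  ... | false with even d o
  ... | z , refl = contradiction (ℕ.∣1⇒≡1 (subst (2 ℕ.∣_) (ℤ.+-injective c)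
    (ℕ.gcd-greatest {2} {∣ + 2 * z ∣} {2} ℕ.∣-refl (ℕ.divides ∣ z ∣ (trans (ℤ.abs-* (+ 2) z) (ℕ.*-comm 2 ∣ z ∣)))))) λ ()

  odd⇔coprime : ∀ d → odd d ≡ true ⇔ gcd (+ 2) d ≡ 1ℤ
  odd⇔coprime d = mk⇔ (odd⇒coprime d) (coprime⇒odd d)

  odd-Σℤ : ∀ k f → odd (Σℤ k f) ≡ sum (odd ∘ f)
  odd-Σℤ zero    f = refl
  odd-Σℤ (suc k) f = trans (odd-+ (f zero) (Σℤ k (f ∘ suc))) (cong (odd (f zero) xor_) (odd-Σℤ k (f ∘ suc)))

  row : ∀ k (a : Fin (suc k) → Fin (suc k) → ℤ) → Fin (suc k) → ℤ
  row k a j = a zero j * det k (λ r c → a (suc r) (punchIn j c))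

  -- The alternating sum local to the definition of det cannot be referred to by name;
  -- unification with an unfolding of det provides it.
  mutual
    alternating : (k : ℕ) → (Fin (suc k) → Fin (suc k) → ℤ) → (l : ℕ) → (Fin l → ℤ) → ℤ
    alternating = _

    det-unfold : ∀ k a → det (suc (suc k)) a ≡
      row (suc k) a zero + - (row (suc k) a (suc zero) + - alternating (suc k) a k (λ i → row (suc k) a (suc (suc i))))
    -- Once the entries, `suc k` and `a` are variables, the unknown function is applied to distinct
    -- variables and is thereby determined.
    det-unfold k a with row (suc k) a zero | row (suc k) a (suc zero) | (λ (i : Fin k) → row (suc k) a (suc (suc i)))
    ... | x | y | f with suc k | a
    ... | _ | _ = refl

  odd-alternating : ∀ k a l f → odd (alternating k a l f) ≡ sum (odd ∘ f)
  odd-alternating k a zero    f = refl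
  odd-alternating k a (suc l) f = trans (odd-+ (f zero) (- alternating k a l (f ∘ suc)))
    (cong (odd (f zero) xor_) (trans (odd-neg (alternating k a l (f ∘ suc))) (odd-alternating k a l (f ∘ suc))))

  odd-det : ∀ k a → odd (det k a) ≡ det₂ k (λ i j → odd (a i j))
  odd-det zero    a = refl
  odd-det (suc k) a = trans (odd-alternating k a (suc k) (row k a)) (sum-cong-≗ (λ j →
    trans (odd-* (a zero j) (det k (λ r c → a (suc r) (punchIn j c))))
      (cong (odd (a zero j) ∧_) (odd-det k (λ r c → a (suc r) (punchIn j c))))))

  det₂-cong : ∀ k {a b : Fin k → Fin k → Bool} → (∀ i j → a i j ≡ b i j) → det₂ k a ≡ det₂ k b
  det₂-cong zero    e = refl
  det₂-cong (suc k) e = sum-cong-≗ (λ j → cong₂ _∧_ (e zero j) (det₂-cong k (λ r c → e (suc r) (punchIn j c))))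

  Σℤ-cong : ∀ k {f g : Fin k → ℤ} → (∀ i → f i ≡ g i) → Σℤ k f ≡ Σℤ k g
  Σℤ-cong zero    e = refl
  Σℤ-cong (suc k) e = cong₂ _+_ (e zero) (Σℤ-cong k (e ∘ suc))

  Σℤ-+ : ∀ k (f g : Fin k → ℤ) → Σℤ k (λ i → f i + g i) ≡ Σℤ k f + Σℤ k g
  Σℤ-+ zero    f g = refl
  Σℤ-+ (suc k) f g = trans (cong (λ z → (f zero + g zero) + z) (Σℤ-+ k (f ∘ suc) (g ∘ suc)))
    (solve 4 (λ a b c d → (a :+ b) :+ (c :+ d) := (a :+ c) :+ (b :+ d)) refl
      (f zero) (g zero) (Σℤ k (f ∘ suc)) (Σℤ k (g ∘ suc)))
    where open ℤ.+-*-Solver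

-- Reduction of coordinate vectors modulo 2.

module Reduction where

  open BooleanDeterminant
  open BooleanAlgebras
  open Parity
  open import Data.Bool using (Bool; true; false; _xor_)
  open import Data.Bool.Properties using (xor-same)
  open import Data.Fin using (Fin; zero; suc; _≟_)
  open import Data.Integer using (ℤ; +_; _+_; _*_; -_; 0ℤ; 1ℤ)
  import Data.Integer.Properties as ℤ
  import Data.Integer.Solver as ℤ
  open import Data.Nat using (zero; suc)
  open import Data.Product using (∃; _,_; proj₁; proj₂)
  open import Data.Vec using (Vec; lookup; tabulate)
  open import Data.Vec.Properties using (lookup∘tabulate; lookup-replicate)
  open import Function using (_∘_)
  open import Relation.Binary.PropositionalEquality
  open import Relation.Nullary using (yes; no)

  red : ∀ {m} → El m → Vec Bool m
  red x = tabulate (odd ∘ x)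

  lookup-red : ∀ {m} (x : El m) i → lookup (red x) i ≡ odd (x i)
  lookup-red x i = lookup∘tabulate (odd ∘ x) i

  red-cong : ∀ {m} {x y : El m} → x ≈ y → red x ≡ red y
  red-cong {x = x} {y} e = vec-ext (λ i → trans (lookup-red x i) (trans (cong odd (e i)) (sym (lookup-red y i))))

  red-+ : ∀ {m} (x y : El m) → red (addE x y) ≡ red x ⊕ red y
  red-+ x y = vec-ext (λ i → trans (lookup-red (addE x y) i) (trans (odd-+ (x i) (y i))
    (sym (trans (lookup-⊕ (red x) (red y) i) (cong₂ _xor_ (lookup-red x i) (lookup-red y i))))))

  bitℤ : Bool → ℤ
  bitℤ false = 0ℤ
  bitℤ true  = 1ℤ

  odd-bitℤ : ∀ b → odd (bitℤ b) ≡ b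
  odd-bitℤ false = refl
  odd-bitℤ true  = refl

  lift : ∀ {m} → Vec Bool m → El m
  lift v i = bitℤ (lookup v i)

  red-lift : ∀ {m} (v : Vec Bool m) → red (lift v) ≡ v
  red-lift v = vec-ext (λ i → trans (lookup-red (lift v) i) (odd-bitℤ (lookup v i)))

  red-basis : ∀ {m} (i : Fin m) → red (basis i) ≡ unit i
  red-basis i = vec-ext (λ k → trans (lookup-red (basis i) k) (odd-basis i k))
    where
    odd-basis : ∀ {m} (i k : Fin m) → odd (basis i k) ≡ lookup (unit i) k
    odd-basis zero    zero    = refl
    odd-basis zero    (suc k) = sym (lookup-replicate k false)
    odd-basis (suc i) zero    = refl
    odd-basis (suc i) (suc k) with i ≟ k | odd-basis i k
    ... | yes _ | e = e
    ... | no  _ | e = e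

  red-≡⇒≈ : ∀ {m} (x y : El m) → red x ≡ red y → ∃ λ z → x ≈ addE y (addE z z)
  red-≡⇒≈ x y e = (λ i → proj₁ (halves i)) , λ i → trans
    (solve 2 (λ x y → x := y :+ (x :- y)) refl (x i) (y i))
    (cong (λ z → y i + z) (trans (proj₂ (halves i)) (solve 1 (λ z → con (+ 2) :* z := z :+ z) refl (proj₁ (halves i)))))
    where
    open ℤ.+-*-Solver
    halves : ∀ i → ∃ λ z → x i + - y i ≡ + 2 * z
    halves i = even (x i + - y i) (trans (odd-+ (x i) (- y i)) (trans
      (cong₂ _xor_ (trans (sym (lookup-red x i)) (trans (cong (λ v → lookup v i) e) (lookup-red y i))) (odd-neg (y i)))
      (xor-same (odd (y i)))))

-- The order as a commutative ring, and its reduction modulo 2.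

module OrderReduction {m : ℕ} (O : Order m) where

  open BooleanDeterminant
  open BooleanAlgebras
  open Parity
  open import Data.Bool using (Bool; _∧_)
  open import Data.Fin using (Fin)
  open import Data.Integer using (ℤ; +_; _+_; _*_; -_)
  import Data.Integer.Properties as ℤ
  import Data.Integer.Solver as ℤ
  open import Data.Nat using (ℕ)
  open import Data.Product using (∃₂; _,_)
  open import Data.Vec using (Vec; lookup)
  open import Level using (0ℓ)
  open import Relation.Binary.PropositionalEquality
  open Reduction

  open Order O

  private
    c = str

  mulO-cong : ∀ {x x′ y y′} → x ≈ x′ → y ≈ y′ → mulO O x y ≈ mulO O x′ y′
  mulO-cong e f k = Σℤ-cong m (λ i → Σℤ-cong m (λ j → cong₂ (λ s t → s * t * c i j k) (e i) (f j)))

  mulO-distribˡ : ∀ x y z → mulO O x (addE y z) ≈ addE (mulO O x y) (mulO O x z)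
  mulO-distribˡ x y z k = trans
    (Σℤ-cong m (λ i → trans
      (Σℤ-cong m (λ j → solve 4 (λ x y z c → x :* (y :+ z) :* c := x :* y :* c :+ x :* z :* c) refl
        (x i) (y j) (z j) (c i j k)))
      (Σℤ-+ m (λ j → x i * y j * c i j k) (λ j → x i * z j * c i j k))))
    (Σℤ-+ m (λ i → Σℤ m (λ j → x i * y j * c i j k)) (λ i → Σℤ m (λ j → x i * z j * c i j k)))
    where open ℤ.+-*-Solver

  mulO-distribʳ : ∀ x y z → mulO O (addE y z) x ≈ addE (mulO O y x) (mulO O z x)
  mulO-distribʳ x y z k = trans (mul-comm (addE y z) x k) (trans (mulO-distribˡ x y z k)
    (cong₂ _+_ (mul-comm x y k) (mul-comm x z k)))

  ring : CommutativeRing 0ℓ 0ℓ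
  ring = record
    { Carrier = El m
    ; _≈_ = _≈_
    ; _+_ = addE
    ; _*_ = mulO O
    ; -_ = λ x k → - x k
    ; 0# = zeroE
    ; 1# = one
    ; isCommutativeRing = record
      { isRing = record
        { +-isAbelianGroup = record
          { isGroup = record
            { isMonoid = record
              { isSemigroup = record
                { isMagma = record
                  { isEquivalence = record
                    { refl = λ k → refl ; sym = λ e k → sym (e k) ; trans = λ e f k → trans (e k) (f k) }
                  ; ∙-cong = λ e f k → cong₂ _+_ (e k) (f k)
                  }
                ; assoc = λ x y z k → ℤ.+-assoc (x k) (y k) (z k)
                }
              ; identity = (λ x k → ℤ.+-identityˡ (x k)) , (λ x k → ℤ.+-identityʳ (x k))
              }
            ; inverse = (λ x k → ℤ.+-inverseˡ (x k)) , (λ x k → ℤ.+-inverseʳ (x k))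
            ; ⁻¹-cong = λ e k → cong -_ (e k)
            }
          ; comm = λ x y k → ℤ.+-comm (x k) (y k)
          }
        ; *-cong = mulO-cong
        ; *-assoc = mul-assoc
        ; *-identity = mul-one , (λ x k → trans (mul-comm x one k) (mul-one x k))
        ; distrib = mulO-distribˡ , mulO-distribʳ
        }
      ; *-comm = mul-comm
      }
    }

  infixl 7 _⊛_
  -- Residue classes are multiplied through their representatives with coordinates 0 and 1; by
  -- `red-*` any other representatives give the same class.
  _⊛_ : Vec Bool m → Vec Bool m → Vec Bool m
  v ⊛ w = red (mulO O (lift v) (lift w))

  odd-mulO : ∀ x y k → odd (mulO O x y k) ≡ sum (λ i → sum (λ j → (odd (x i) ∧ odd (y j)) ∧ odd (c i j k)))
  odd-mulO x y k = trans (odd-Σℤ m (λ i → Σℤ m (λ j → x i * y j * c i j k))) (sum-cong-≗ (λ i →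
    trans (odd-Σℤ m (λ j → x i * y j * c i j k)) (sum-cong-≗ (λ j →
      trans (odd-* (x i * y j) (c i j k)) (cong (_∧ odd (c i j k)) (odd-* (x i) (y j)))))))

  red-* : ∀ x y → red (mulO O x y) ≡ red x ⊛ red y
  red-* x y = vec-ext (λ k → trans (lookup-red (mulO O x y) k) (trans (odd-mulO x y k) (trans
    (sum-cong-≗ (λ i → sum-cong-≗ (λ j → cong₂ (λ s t → (s ∧ t) ∧ odd (c i j k)) (bits x i) (bits y j))))
    (sym (trans (lookup-red (mulO O (lift (red x)) (lift (red y))) k) (odd-mulO (lift (red x)) (lift (red y)) k))))))
    where
    bits : ∀ (x : El m) i → odd (x i) ≡ odd (lift (red x) i)
    bits x i = trans (sym (lookup-red x i)) (sym (odd-bitℤ (lookup (red x) i)))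

  mod2 : F₂Algebra m
  mod2 = record
    { _*_ = _⊛_
    ; 1# = red one
    ; *-comm = λ u v → red-cong (mul-comm (lift u) (lift v))
    ; *-assoc = λ u v w → begin
        (u ⊛ v) ⊛ w                              ≡⟨ cong ((u ⊛ v) ⊛_) (sym (red-lift w)) ⟩
        red (mulO O (lift u) (lift v)) ⊛ red (lift w) ≡⟨ sym (red-* (mulO O (lift u) (lift v)) (lift w)) ⟩
        red (mulO O (mulO O (lift u) (lift v)) (lift w)) ≡⟨ red-cong (mul-assoc (lift u) (lift v) (lift w)) ⟩
        red (mulO O (lift u) (mulO O (lift v) (lift w))) ≡⟨ red-* (lift u) (mulO O (lift v) (lift w)) ⟩
        red (lift u) ⊛ (v ⊛ w)                   ≡⟨ cong (_⊛ (v ⊛ w)) (red-lift u) ⟩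
        u ⊛ (v ⊛ w)                              ∎
    ; *-identityˡ = λ v → begin
        red one ⊛ v                  ≡⟨ cong (red one ⊛_) (sym (red-lift v)) ⟩
        red one ⊛ red (lift v)       ≡⟨ sym (red-* one (lift v)) ⟩
        red (mulO O one (lift v))    ≡⟨ red-cong (mul-one (lift v)) ⟩
        red (lift v)                 ≡⟨ red-lift v ⟩
        v                            ∎
    ; distribˡ = λ u v w → begin
        u ⊛ (v ⊕ w)
          ≡⟨ cong₂ _⊛_ (sym (red-lift u)) (trans (cong₂ _⊕_ (sym (red-lift v)) (sym (red-lift w))) (sym (red-+ (lift v) (lift w)))) ⟩
        red (lift u) ⊛ red (addE (lift v) (lift w))
          ≡⟨ sym (red-* (lift u) (addE (lift v) (lift w))) ⟩
        red (mulO O (lift u) (addE (lift v) (lift w)))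
          ≡⟨ red-cong (mulO-distribˡ (lift u) (lift v) (lift w)) ⟩
        red (addE (mulO O (lift u) (lift v)) (mulO O (lift u) (lift w)))
          ≡⟨ red-+ (mulO O (lift u) (lift v)) (mulO O (lift u) (lift w)) ⟩
        u ⊛ v ⊕ u ⊛ w ∎
    }
    where open ≡-Reasoning

  open F₂Algebra mod2 using (tr; gram; Perfect)

  odd-trace : ∀ x → odd (trace O x) ≡ tr (red x)
  odd-trace x = trans (odd-Σℤ m (λ i → mulO O x (basis i) i)) (sum-cong-≗ (λ i → trans
    (sym (lookup-red (mulO O x (basis i)) i))
    (cong (λ v → lookup v i) (trans (red-* x (basis i)) (cong (red x ⊛_) (red-basis i))))))

  -- Determinant, trace and multiplication all commute with reduction modulo 2.
  odd-disc : odd (disc O) ≡ det₂ m gram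
  odd-disc = trans (odd-det m (λ i j → trace O (mulO O (basis i) (basis j)))) (det₂-cong m (λ i j → trans
    (odd-trace (mulO O (basis i) (basis j)))
    (cong tr (trans (red-* (basis i) (basis j)) (cong₂ _⊛_ (red-basis i) (red-basis j))))))

  perfect⇒square+double : Perfect → ∀ x → ∃₂ λ y z → x ≈ addE (mulO O y y) (addE z z)
  perfect⇒square+double perfect x with perfect (red x)
  ... | v , e with red-≡⇒≈ x (mulO O (lift v) (lift v)) (sym e)
  ... | z , e′ = lift v , z , e′

-- Matrix traces modulo 2, and both directions of the equivalence.

module Bridge {m : ℕ} (O : Order m) where

  open BooleanDeterminant
  open BooleanAlgebras
  open Parity
  open Reduction
  open import Data.Bool using (Bool; true; false)
  open import Data.Fin using (Fin; zero; suc)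
  open import Data.Integer using (ℤ; +_; _+_)
  import Data.Integer.Properties as ℤ
  open import Data.Nat using (ℕ; zero; suc)
  open import Data.Product using (∃; _,_)
  open import Data.Vec using (Vec)
  import Data.Vec.Properties
  open import Data.Vec.Functional using () renaming (_∷_ to _∷ᶠ_)
  open import Function using (_∘_; _⇔_; mk⇔)
  open import Relation.Binary.PropositionalEquality
  import Algebra.Properties.Semiring.Sum

  open OrderReduction O
  open F₂Algebra mod2 using (Perfect; square; square-⊕; zeroʳ)

  module B = Algebra.Properties.Semiring.Sum (CommutativeRing.semiring (algebraRing mod2))
  module R = Algebra.Properties.Semiring.Sum (CommutativeRing.semiring ring)

  trace₂ : ∀ {n} → Mat O n → Vec Bool m
  trace₂ A = B.sum (λ i → red (A i i))

  red-Σℤ : ∀ n (f : Fin n → El m) → red (λ k → Σℤ n (λ l → f l k)) ≡ B.sum (λ l → red (f l))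
  red-Σℤ zero    f = vec-ext (λ i → trans (lookup-red zeroE i) (sym (Data.Vec.Properties.lookup-replicate i false)))
  red-Σℤ (suc n) f = trans (red-+ (f zero) (λ k → Σℤ n (λ l → f (suc l) k))) (cong (red (f zero) ⊕_) (red-Σℤ n (f ∘ suc)))

  trace₂-square : ∀ {n} (A : Mat O n) → trace₂ (mulM O A A) ≡ square (trace₂ A)
  trace₂-square {n} A = trans
    (B.sum-cong-≗ (λ i → trans (red-Σℤ n (λ l → mulO O (A i l) (A l i))) (B.sum-cong-≗ (λ l → red-* (A i l) (A l i)))))
    (Characteristic2.trace-square (algebraRing mod2) ⊕-same (λ i l → red (A i l)))

  -- An eighth power is the square of a fourth power, so its trace is a square modulo 2; in
  -- characteristic 2, sums of squares are squares.
  trace₂-sum : ∀ {n} r (Ms : Fin r → Mat O n) → ∃ λ w → square w ≡ trace₂ (sumM O r (λ i → pow8 O (Ms i)))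
  trace₂-sum {n} zero Ms = 𝟎 , trans (zeroʳ 𝟎) (sym (trans (B.sum-cong-≗ {n} (λ i → red-zeroE)) (B.sum-replicate-zero n)))
    where
    red-zeroE : red {m} zeroE ≡ 𝟎
    red-zeroE = red-Σℤ 0 (λ ())
  trace₂-sum (suc r) Ms with trace₂-sum r (Ms ∘ suc)
  ... | w , e = trace₂ A⁴ ⊕ w , trans (square-⊕ (trace₂ A⁴) w)
    (trans (cong₂ _⊕_ (sym (trace₂-square A⁴)) e) (sym (trans
      (B.sum-cong-≗ (λ i → red-+ (pow8 O (Ms zero) i i) (sumM O r (λ j → pow8 O (Ms (suc j))) i i)))
      (B.∑-distrib-+ (λ i → red (pow8 O (Ms zero) i i)) (λ i → red (sumM O r (λ j → pow8 O (Ms (suc j))) i i))))))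
    where
    A² = mulM O (Ms zero) (Ms zero)
    A⁴ = mulM O A² A²

  corner : ∀ {n} → El m → Mat O (suc n)
  corner x zero    zero    = x
  corner x zero    (suc j) = zeroE
  corner x (suc i) j       = zeroE

  trace₂-corner : ∀ {n} x → trace₂ (corner {n} x) ≡ red x
  trace₂-corner {n} x = trans (cong (red x ⊕_) (trans (B.sum-cong-≗ {n} (λ i → red-Σℤ 0 (λ ()))) (B.sum-replicate-zero n)))
    (⊕-identityʳ (red x))

  trace₂-eighths : ∀ {n} {M : Mat O n} → SumOfEighthPowers O M → ∃ λ w → square w ≡ trace₂ M
  trace₂-eighths (r , Ms , e) = let w , w² = trace₂-sum (suc r) Ms in
    w , trans w² (B.sum-cong-≗ (λ i → red-cong (e i i)))

  -- A single corner entry already realises every residue class as a trace.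
  necessity : ∀ {n} → ((M : Mat O (suc n)) → SumOfEighthPowers O M) → Perfect
  necessity {n} all v = let w , w² = trace₂-eighths (all (corner (lift v))) in
    w , trans w² (trans (trace₂-corner {n} (lift v)) (red-lift v))

  sum-Σℤ : ∀ n (f : Fin n → El m) k → R.sum f k ≡ Σℤ n (λ l → f l k)
  sum-Σℤ zero    f k = refl
  sum-Σℤ (suc n) f k = cong (λ z → f zero k + z) (sum-Σℤ n (f ∘ suc) k)

  open SquareMatrices ring using (_⊠_; _≋_; ⊠-cong; ≋-trans; S-matrix) renaming (pow8 to pow8ᴿ)

  ⊠-mulM : ∀ {n} (A B : Mat O n) → A ⊠ B ≋ mulM O A B
  ⊠-mulM {n} A B i j = sum-Σℤ n (λ l → mulO O (A i l) (B l j))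

  pow8ᴿ-pow8 : ∀ {n} (A : Mat O n) → pow8ᴿ A ≋ pow8 O A
  pow8ᴿ-pow8 A = ≋-trans (⊠-cong e⁴ e⁴) (⊠-mulM A⁴ A⁴)
    where
    A² = mulM O A A
    A⁴ = mulM O A² A²
    e⁴ : (A ⊠ A) ⊠ (A ⊠ A) ≋ A⁴
    e⁴ = ≋-trans (⊠-cong (⊠-mulM A A) (⊠-mulM A A)) (⊠-mulM A² A²)

  S : ∀ {n} → Mat O n → Set
  S = SumOfEighthPowers O

  S-resp : ∀ {n} {A B : Mat O n} → A ≋ B → S A → S B
  S-resp e (r , Ms , f) = r , Ms , λ i j k → trans (f i j k) (e i j k)

  S-cons : ∀ {n} (A : Mat O n) {N} → S N → S (addM O (pow8 O A) N)
  S-cons A (r , Ms , f) = suc r , A ∷ᶠ Ms , λ i j k → cong (λ z → pow8 O A i j k + z) (f i j k)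

  S-+ : ∀ {n} {A B : Mat O n} → S A → S B → S (addM O A B)
  S-+ {n} {A} {B} (r , Ms , f) s = S-resp (λ i j k → cong (_+ B i j k) (f i j k)) (prepend (suc r) Ms)
    where
    prepend : ∀ r (Ms : Fin r → Mat O n) → S (addM O (sumM O r (λ i → pow8 O (Ms i))) B)
    prepend zero    Ms = S-resp (λ i j k → sym (ℤ.+-identityˡ (B i j k))) s
    prepend (suc r) Ms = S-resp
      (λ i j k → sym (ℤ.+-assoc (pow8 O (Ms zero) i j k) (sumM O r (λ l → pow8 O (Ms (suc l))) i j k) (B i j k)))
      (S-cons (Ms zero) (prepend r (Ms ∘ suc)))

  S-8 : ∀ {n} (A : Mat O n) → S (pow8ᴿ A)
  -- The index 0 stands for one summand, since sums have length `suc r`.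
  S-8 A = 0 , (λ _ → A) , λ i j k → trans (ℤ.+-identityʳ (pow8 O A i j k)) (sym (pow8ᴿ-pow8 A i j k))

  sufficiency : ∀ {n} → Perfect → (M : Mat O (suc (suc n))) → SumOfEighthPowers O M
  sufficiency perfect = S-matrix S (λ {A} {B} → S-resp {A = A} {B}) (λ {A} {B} → S-+ {A = A} {B}) S-8 λ x →
    let y , z , e = perfect⇒square+double perfect x in
    y , z , λ k → trans (e k) (cong (λ t → mulO O y y k + t) (sym (double z k)))
    where
    open Order O
    -- In the matrix argument the integer 2 acts as the ring element `addE one one`, whereas
    -- reduction modulo 2 produces `addE z z`.
    double : ∀ z → mulO O (addE one one) z ≈ addE z z
    double z k = trans (mulO-distribʳ z one one k) (cong₂ _+_ (mul-one z k) (mul-one z k))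

  eighths⇔odd-disc : ∀ n → ((M : Mat O (suc (suc n))) → SumOfEighthPowers O M) ⇔ odd (disc O) ≡ true
  eighths⇔odd-disc n = mk⇔
    (λ all → trans odd-disc (perfect⇒det₂ (necessity all)))
    (λ odd≡true → sufficiency (det₂⇒perfect (trans (sym odd-disc) odd≡true)))
    where
    open Separability mod2 using (perfect⇒det₂)
    open F₂Algebra mod2 using (det₂⇒perfect)

open import Data.Nat using (suc; _≤_; s≤s)
open import Data.Integer using (+_)
open import Data.Integer.GCD using (gcd)
open import Relation.Binary.PropositionalEquality using (_≡_)
open import Function.Bundles using (_⇔_)
open import Function.Construct.Composition using (_⇔-∘_)

theorem5p3 : ∀ {m : ℕ} (O : Order (suc m)) (n : ℕ) → 2 ≤ n →
    (((M : Mat O n) → SumOfEighthPowers O M) ⇔ (gcd (+ 2) (disc O) ≡ + 1))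
theorem5p3 O 1 (s≤s ())
theorem5p3 O (suc (suc n)) _ = Parity.odd⇔coprime (disc O) ⇔-∘ Bridge.eighths⇔odd-disc O n
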